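{- Let $p$ be a sufficiently large prime and $\mathcal{A}$ a zero-free subset of $\mathbb{Z}/p\mathbb{Z}$ of the largest cardinality. Then $\operatorname{card}(\mathcal{A})=[\sqrt{2p}]-\delta(p)$, where $\delta(p)=0$ if $s(\sqrt{2p}):=\frac{[\sqrt{2p}]([\sqrt{2p}]+1)}{2}\le p+1$ and $\delta(p)=1$ otherwise. In other words, $\operatorname{card}(\mathcal{A})$ is the largest integer $k$ with $\frac{k(k+1)}{2}\le p+1$; that is, $\operatorname{card}(\mathcal{A})=\left[\sqrt{2p+9/4}-1/2\right]$.
   Context: $\mathcal{A}\subset\mathbb{Z}/p\mathbb{Z}$ is zero-free if $0$ is not a sum of the elements of any nonempty subset of $\mathcal{A}$. $[t]$ denotes the integer part of $t$. -}

module Defs where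

open import Data.Nat using (ℕ; zero; suc; _+_; _*_; _≤_; _<_)
open import Data.Nat.Divisibility using (_∣_)
open import Data.Bool using (true; false)
open import Data.Fin using (Fin; toℕ)
open import Data.Fin.Subset using (Subset; _⊆_; Nonempty; ∣_∣)
open import Data.Vec using (Vec; []; _∷_)
open import Relation.Nullary using (¬_)

-- Elements of ℤ/pℤ are represented by Fin p (residues 0,…,p-1).
-- Sum (as a natural number) of the residues toℕ x for x in the subset.
subsetSum : ∀ {n} → Subset n → ℕ
subsetSum {n} B = go B 0
  where
  go : ∀ {m} → Vec _ m → ℕ → ℕ
  go [] k = 0
  go (true ∷ bs) k = k + go bs (suc k)
  go (false ∷ bs) k = go bs (suc k)

ZeroFree : (p : ℕ) → Subset p → Set
ZeroFree p A = ∀ (B : Subset p) → B ⊆ A → Nonempty B → ¬ (p ∣ subsetSum B)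

MaxZeroFree : (p : ℕ) → Subset p → Set
MaxZeroFree p A = ZeroFree p A × (∀ (B : Subset p) → ZeroFree p B → ∣ B ∣ ≤ ∣ A ∣)
  where open import Data.Product using (_×_)

IsFloorSqrt : ℕ → ℕ → Set
IsFloorSqrt n k = (k * k ≤ n) × (n < suc k * suc k)
  where open import Data.Product using (_×_)

{-# OPTIONS --safe #-}

-- The set {1, …, k} is zero-free when k(k+1)/2 < p, and k(k+1)/2 is neither p nor p + 1 for a
-- prime p ≥ 11, so it suffices that every zero-free set A of size K satisfies K(K+1)/2 < p.
--
-- The sum over all x ∈ (ℤ/pℤ)ᵏ of a product of at most k(p-1) affine forms in x depends only on
-- the linear parts of the forms: changing one constant alters it by the sum of a product of fewer
-- than k(p-1) forms, which vanishes as in the Chevalley–Warning theorem.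
--
-- If K(K+1)/2 ≥ p, pick k ≤ K with (k-1)k/2 < p ≤ k(k+1)/2 and distinct a₀, …, aₖ₋₁ in A.  With
-- L = x₀ + ⋯ + xₖ₋₁ and t = p - (k-1)k/2, use exactly k(p-1) forms whose product is nonzero at x
-- just when L = c₀, xᵢ ≠ ±xⱼ for i ≠ j, x₀ ∈ {a₀, …, aₜ₋₁}, and
-- xᵢ ∈ {a₀, …, aₖ₋₁} ∪ {-a₀, …, -aᵢ} for i ≥ 1.  At such a point x is, up to order and signs, the
-- sequence a, with at least one positive sign.  For c₀ = -(a₀ + ⋯ + aₖ₋₁) the elements with
-- positive sign would have sum zero, so every product vanishes.
-- Now replace a by the sequence s+1, …, k, s, …, 1 with s = k - t, and c₀ by
-- a₀ - a₁ - ⋯ - aₖ₋₁.  The linear parts are unchanged, but exactly one point, namely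
-- (a₀, -a₁, …, -aₖ₋₁), gives a nonzero product, so the sum is nonzero: a contradiction.
module Submission where

open import Defs
open import Data.Bool.Base using (true; false)
open import Data.Nat.Base as ℕ using (ℕ; zero; suc; _≤_; _>_)
import Data.Nat.Properties as ℕ
import Data.Nat.Divisibility as ℕ
open import Data.Nat.DivMod using (_/_; m*n/n≡m)
open import Data.Nat.ListAction using () renaming (sum to sumℕ)
open import Data.Nat.ListAction.Properties using (sum-↭; sum-++)
open import Data.Nat.Primality using (Prime; euclidsLemma; prime⇒nonTrivial; prime⇒nonZero)
open import Data.Nat.Tactic.RingSolver renaming (solve-∀ to ℕ-solve-∀)
open import Data.Integer.Base as ℤ using (ℤ; +_; 0ℤ; 1ℤ)
import Data.Integer.Properties as ℤ
open import Data.Integer.DivMod using (_/ℕ_; n%ℕd<d; a≡a%ℕn+[a/ℕn]*n)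
open import Data.Integer.Divisibility.Signed as ℤ∣ using (_∣_; divides)
open import Data.Integer.Tactic.RingSolver using (solve-∀)
open import Algebra.Properties.Semiring.Sum ℤ.+-*-semiring
  using (sum; sum-cong-≗; *-distribˡ-sum; *-distribʳ-sum; ∑-distrib-+)
open import Data.Fin.Base as Fin using (Fin; zero; suc; toℕ)
import Data.Fin.Properties as Fin
open import Data.Fin.Subset using (Subset; ⁅_⁆; _∪_; _⊆_)
  renaming (⊥ to ∅; _∈_ to _∈ₛ_; _∉_ to _∉ₛ_)
import Data.Fin.Subset.Properties as Subset
open import Data.List.Base as List using (List; []; _∷_; _++_; length)
import Data.List.Properties as List
open import Data.List.Membership.Propositional using (_∈_)
open import Data.List.Membership.Propositional.Properties
open import Data.List.Relation.Binary.Permutation.Propositional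
  using (_↭_; ↭-refl; ↭-sym; ↭-trans; prep; ↭⇒↭ₛ)
import Data.List.Relation.Binary.Permutation.Propositional.Properties as ↭
import Data.List.Relation.Binary.Permutation.Setoid.Properties as ↭ₛ
open import Data.List.Relation.Binary.Pointwise as Pointwise using (Pointwise; []; _∷_)
open import Data.List.Relation.Unary.All as All using (All; []; _∷_)
import Data.List.Relation.Unary.All.Properties as All
open import Data.List.Relation.Unary.AllPairs using (AllPairs; []; _∷_)
import Data.List.Relation.Unary.AllPairs.Properties as AllPairs
import Data.List.Relation.Unary.Any as Any
open import Data.List.Relation.Unary.Unique.Propositional using (Unique)
import Data.List.Relation.Unary.Unique.Propositional.Properties as Unique
open import Data.Product.Base using (Σ; ∃; ∃₂; _×_; _,_; proj₁; proj₂)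
open import Data.Sum.Base as Sum using (_⊎_; inj₁; inj₂; [_,_]′)
open import Data.Vec.Base as Vec using (Vec; []; _∷_; here; there; lookup)
import Data.Vec.Properties as Vec
open import Function.Base using (_∘_; id)
open import Relation.Binary.Bundles using (Setoid)
open import Relation.Binary.PropositionalEquality
import Relation.Binary.Reasoning.Setoid as SetoidReasoning
open import Relation.Nullary using (¬_; Dec; yes; no; contradiction; ¬?)
import Relation.Nullary.Decidable as Dec

-- Arithmetic modulo p

module Mod (p : ℕ) where

  open import Data.Integer.Base using (-_; _+_; _*_; _-_; ∣_∣)

  infix 4 _≈_ _≉_ _≈?_

  -- A record, not a synonym for divisibility, so that `x` and `y` can be inferred from the type of
  -- a proof.
  record _≈_ (x y : ℤ) : Set where
    constructor congruent
    field difference : + p ∣ x - y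

  _≉_ : ℤ → ℤ → Set
  x ≉ y = ¬ x ≈ y

  abstract
    _≈?_ : ∀ x y → Dec (x ≈ y)
    x ≈? y = Dec.map′ congruent _≈_.difference (+ p ℤ∣.∣? x - y)

  private
    rewritten : ∀ {x y z} → z ≡ x - y → + p ∣ z → x ≈ y
    rewritten eq d = congruent (subst (+ p ∣_) eq d)

  ≈-reflexive : ∀ {x y} → x ≡ y → x ≈ y
  ≈-reflexive {x} refl = congruent (divides 0ℤ (ℤ.+-inverseʳ x))

  ≈-refl : ∀ {x} → x ≈ x
  ≈-refl = ≈-reflexive refl

  ≈-sym : ∀ {x y} → x ≈ y → y ≈ x
  ≈-sym {x} {y} (congruent d) = rewritten (lemma x y) (ℤ∣.∣m⇒∣-m d)
    where
    lemma : ∀ x y → - (x - y) ≡ y - x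
    lemma = solve-∀

  ≈-trans : ∀ {x y z} → x ≈ y → y ≈ z → x ≈ z
  ≈-trans {x} {y} {z} (congruent d) (congruent e) =
    rewritten (lemma x y z) (ℤ∣.∣m∣n⇒∣m+n d e)
    where
    lemma : ∀ x y z → (x - y) + (y - z) ≡ x - z
    lemma = solve-∀

  ≈-setoid : Setoid _ _
  ≈-setoid = record
    { Carrier = ℤ ; _≈_ = _≈_
    ; isEquivalence = record { refl = ≈-refl ; sym = ≈-sym ; trans = ≈-trans } }

  module ≈-Reasoning = SetoidReasoning ≈-setoid

  +-cong : ∀ {x y u v} → x ≈ y → u ≈ v → x + u ≈ y + v
  +-cong {x} {y} {u} {v} (congruent d) (congruent e) =
    rewritten (lemma x y u v) (ℤ∣.∣m∣n⇒∣m+n d e)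
    where
    lemma : ∀ x y u v → (x - y) + (u - v) ≡ (x + u) - (y + v)
    lemma = solve-∀

  *-cong : ∀ {x y u v} → x ≈ y → u ≈ v → x * u ≈ y * v
  *-cong {x} {y} {u} {v} (congruent d) (congruent e) =
    rewritten (lemma x y u v) (ℤ∣.∣m∣n⇒∣m+n (ℤ∣.∣m⇒∣m*n u d) (ℤ∣.∣n⇒∣m*n y e))
    where
    lemma : ∀ x y u v → (x - y) * u + y * (u - v) ≡ x * u - y * v
    lemma = solve-∀

  +-congˡ : ∀ x {u v} → u ≈ v → x + u ≈ x + v
  +-congˡ x = +-cong (≈-refl {x})

  *-congˡ : ∀ x {u v} → u ≈ v → x * u ≈ x * v
  *-congˡ x = *-cong (≈-refl {x})

  *-congʳ : ∀ x {u v} → u ≈ v → u * x ≈ v * x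
  *-congʳ x u≈v = *-cong u≈v (≈-refl {x})

  -‿cong : ∀ {x y} → x ≈ y → - x ≈ - y
  -‿cong {x} {y} (congruent d) = rewritten (lemma x y) (ℤ∣.∣m⇒∣-m d)
    where
    lemma : ∀ x y → - (x - y) ≡ - x - - y
    lemma = solve-∀

  +-cancelˡ : ∀ x {u v} → x + u ≈ x + v → u ≈ v
  +-cancelˡ x {u} {v} (congruent d) = rewritten (lemma x u v) d
    where
    lemma : ∀ x u v → (x + u) - (x + v) ≡ u - v
    lemma = solve-∀

  x-y≈0⇒x≈y : ∀ {x y} → x - y ≈ 0ℤ → x ≈ y
  x-y≈0⇒x≈y {x} {y} (congruent d) = rewritten (ℤ.+-identityʳ (x - y)) d

  x≈y⇒x-y≈0 : ∀ {x y} → x ≈ y → x - y ≈ 0ℤ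
  x≈y⇒x-y≈0 {x} {y} (congruent d) = rewritten (sym (ℤ.+-identityʳ (x - y))) d

  x≈0⇒y*x≈0 : ∀ y {x} → x ≈ 0ℤ → y * x ≈ 0ℤ
  x≈0⇒y*x≈0 y x≈0 = ≈-trans (*-congˡ y x≈0) (≈-reflexive (ℤ.*-zeroʳ y))

  x≈0⇒x*y≈0 : ∀ {x} y → x ≈ 0ℤ → x * y ≈ 0ℤ
  x≈0⇒x*y≈0 y x≈0 = ≈-trans (*-congʳ y x≈0) (≈-reflexive (ℤ.*-zeroˡ y))

  +≈0 : ∀ {x y} → x ≈ 0ℤ → y ≈ 0ℤ → x + y ≈ 0ℤ
  +≈0 = +-cong

  p≈0 : + p ≈ 0ℤ
  p≈0 = rewritten (sym (ℤ.+-identityʳ (+ p))) ℤ∣.∣-refl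

  ≈0⇒∣ : ∀ {x} → x ≈ 0ℤ → p ℕ.∣ ∣ x ∣
  ≈0⇒∣ {x} (congruent d) = ℤ∣.∣⇒∣ᵤ (subst (+ p ∣_) (ℤ.+-identityʳ x) d)

  <⇒≈0⇒≡0 : ∀ {n} → n ℕ.< p → + n ≈ 0ℤ → n ≡ 0
  <⇒≈0⇒≡0 {zero}  _   _   = refl
  <⇒≈0⇒≡0 {suc n} n<p n≈0 = contradiction (ℕ.∣⇒≤ (≈0⇒∣ n≈0)) (ℕ.<⇒≱ n<p)

  ≈⇒≡ : ∀ {m n} → m ℕ.< p → n ℕ.< p → + m ≈ + n → m ≡ n
  ≈⇒≡ {m} {n} m<p n<p m≈n with ℕ.≤-total n m
  ... | inj₁ n≤m = ℕ.≤-antisym (ℕ.m∸n≡0⇒m≤n (<⇒≈0⇒≡0 (ℕ.≤-<-trans (ℕ.m∸n≤m m n) m<p)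
                     (≈-trans (≈-reflexive (sym (trans (ℤ.m-n≡m⊖n m n) (ℤ.⊖-≥ n≤m))))
                              (x≈y⇒x-y≈0 m≈n)))) n≤m
  ... | inj₂ m≤n = sym (ℕ.≤-antisym (ℕ.m∸n≡0⇒m≤n (<⇒≈0⇒≡0 (ℕ.≤-<-trans (ℕ.m∸n≤m n m) n<p)
                     (≈-trans (≈-reflexive (sym (trans (ℤ.m-n≡m⊖n n m) (ℤ.⊖-≥ m≤n))))
                              (x≈y⇒x-y≈0 (≈-sym m≈n))))) m≤n)

-- Integers modulo a prime

module PrimeMod (p : ℕ) (p-prime : Prime p) where

  open import Data.Integer.Base using (-_; _+_; _*_; _-_; ∣_∣)
  open Mod p public

  private instance
    p-nonZero : ℕ.NonZero p
    p-nonZero = prime⇒nonZero p-prime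

  x*y≈0⇒x≈0∨y≈0 : ∀ x y → x * y ≈ 0ℤ → x ≈ 0ℤ ⊎ y ≈ 0ℤ
  x*y≈0⇒x≈0∨y≈0 x y xy≈0 = Sum.map ≈0 ≈0
    (euclidsLemma ∣ x ∣ ∣ y ∣ p-prime (subst (p ℕ.∣_) (ℤ.abs-* x y) (≈0⇒∣ xy≈0)))
    where
    ≈0 : ∀ {z} → p ℕ.∣ ∣ z ∣ → z ≈ 0ℤ
    ≈0 {z} d = congruent (subst (+ p ∣_) (sym (ℤ.+-identityʳ z)) (ℤ∣.∣ᵤ⇒∣ d))

  residue : ℤ → Fin p
  residue z = Fin.fromℕ< (n%ℕd<d z p)

  residue-≈ : ∀ z → + toℕ (residue z) ≈ z
  residue-≈ z = ≈-sym (≈-trans (≈-reflexive eq) (≈-trans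
      (+-congˡ (+ toℕ (residue z)) (x≈0⇒y*x≈0 (z /ℕ p) p≈0)) (≈-reflexive (ℤ.+-identityʳ _))))
    where
    eq : z ≡ + toℕ (residue z) + (z /ℕ p) * + p
    eq = trans (a≡a%ℕn+[a/ℕn]*n z p)
               (cong (λ m → + m + (z /ℕ p) * + p) (sym (Fin.toℕ-fromℕ< (n%ℕd<d z p))))

  toℕ-≈-injective : ∀ {i j : Fin p} → + toℕ i ≈ + toℕ j → i ≡ j
  toℕ-≈-injective {i} {j} eq = Fin.toℕ-injective (≈⇒≡ (Fin.toℕ<n i) (Fin.toℕ<n j) eq)

  sum-≈ : ∀ {n} {f g : Fin n → ℤ} → (∀ i → f i ≈ g i) → sum f ≈ sum g
  sum-≈ {zero}  f≈g = ≈-refl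
  sum-≈ {suc n} f≈g = +-cong (f≈g zero) (sum-≈ (f≈g ∘ suc))

  sum-≈0 : ∀ {n} {f : Fin n → ℤ} → (∀ i → f i ≈ 0ℤ) → sum f ≈ 0ℤ
  sum-≈0 {zero}  f≈0 = ≈-refl
  sum-≈0 {suc n} f≈0 = +≈0 (f≈0 zero) (sum-≈0 (f≈0 ∘ suc))

  sum-supported : ∀ {n} {f : Fin n → ℤ} i → (∀ j → j ≢ i → f j ≈ 0ℤ) → sum f ≈ f i
  sum-supported {f = f} zero f≈0 =
    ≈-trans (+-congˡ (f zero) (sum-≈0 (λ j → f≈0 (suc j) λ ())))
            (≈-reflexive (ℤ.+-identityʳ (f zero)))
  sum-supported {f = f} (suc i) f≈0 =
    ≈-trans (+-cong (f≈0 zero λ ())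
                    (sum-supported i (λ j j≢i → f≈0 (suc j) (j≢i ∘ Fin.suc-injective))))
            (≈-reflexive (ℤ.+-identityˡ (f (suc i))))

  -- Sums over (ℤ/pℤ)ᵏ

  Point : ℕ → Set
  Point = Vec (Fin p)

  coord : ∀ {k} → Point k → Fin k → ℤ
  coord x i = + toℕ (lookup x i)

  ∑ : ∀ k → (Point k → ℤ) → ℤ
  ∑ zero    f = f []
  ∑ (suc k) f = sum (λ i → ∑ k (λ x → f (i ∷ x)))

  ∑-≈ : ∀ k {f g : Point k → ℤ} → (∀ x → f x ≈ g x) → ∑ k f ≈ ∑ k g
  ∑-≈ zero    f≈g = f≈g []
  ∑-≈ (suc k) f≈g = sum-≈ (λ i → ∑-≈ k (λ x → f≈g (i ∷ x)))

  ∑-≡ : ∀ k {f g : Point k → ℤ} → (∀ x → f x ≡ g x) → ∑ k f ≈ ∑ k g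
  ∑-≡ k f≡g = ∑-≈ k (≈-reflexive ∘ f≡g)

  ∑-≈0 : ∀ k {f : Point k → ℤ} → (∀ x → f x ≈ 0ℤ) → ∑ k f ≈ 0ℤ
  ∑-≈0 zero    f≈0 = f≈0 []
  ∑-≈0 (suc k) f≈0 = sum-≈0 (λ i → ∑-≈0 k (λ x → f≈0 (i ∷ x)))

  ∑-+ : ∀ k (f g : Point k → ℤ) → ∑ k (λ x → f x + g x) ≈ ∑ k f + ∑ k g
  ∑-+ zero    f g = ≈-refl
  ∑-+ (suc k) f g =
    ≈-trans (sum-≈ (λ i → ∑-+ k (f ∘ (i ∷_)) (g ∘ (i ∷_))))
            (≈-reflexive (∑-distrib-+ (λ i → ∑ k (f ∘ (i ∷_))) (λ i → ∑ k (g ∘ (i ∷_)))))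

  ∑-* : ∀ k c (f : Point k → ℤ) → ∑ k (λ x → c * f x) ≈ c * ∑ k f
  ∑-* zero    c f = ≈-refl
  ∑-* (suc k) c f =
    ≈-trans (sum-≈ (λ i → ∑-* k c (f ∘ (i ∷_))))
            (≈-reflexive (sym (*-distribˡ-sum c (λ i → ∑ k (f ∘ (i ∷_))))))

  ∑-supported : ∀ {k} {f : Point k → ℤ} x → (∀ y → y ≢ x → f y ≈ 0ℤ) → ∑ k f ≈ f x
  ∑-supported []      f≈0 = ≈-refl
  ∑-supported (i ∷ x) f≈0 = ≈-trans
    (sum-supported i (λ j j≢i → ∑-≈0 _ (λ y → f≈0 (j ∷ y) (j≢i ∘ Vec.∷-injectiveˡ))))
    (∑-supported x (λ y y≢x → f≈0 (i ∷ y) (y≢x ∘ Vec.∷-injectiveʳ)))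

  -- Falling factorials, whose sums over an interval telescope.
  infix 8 _↓_
  _↓_ : ℤ → ℕ → ℤ
  x ↓ zero  = 1ℤ
  x ↓ suc e = x ↓ e * (x - + e)

  ↓-cong : ∀ e {x y} → x ≈ y → x ↓ e ≈ y ↓ e
  ↓-cong zero    x≈y = ≈-refl
  ↓-cong (suc e) x≈y = *-cong (↓-cong e x≈y) (+-cong x≈y ≈-refl)

  -- The recursion splits off the last factor; splitting off the first one instead is what lets
  -- `sum-↓` telescope.
  ↓-shift : ∀ x e → (1ℤ + x) ↓ suc e ≡ (1ℤ + x) * x ↓ e
  ↓-shift x zero    = lemma x
    where
    lemma : ∀ x → 1ℤ * ((1ℤ + x) - 0ℤ) ≡ (1ℤ + x) * 1ℤ
    lemma = solve-∀
  ↓-shift x (suc e) = trans (cong (_* ((1ℤ + x) - + suc e)) (↓-shift x e)) (lemma x (x ↓ e) (+ e))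
    where
    lemma : ∀ x f e → (1ℤ + x) * f * ((1ℤ + x) - (1ℤ + e)) ≡ (1ℤ + x) * (f * (x - e))
    lemma = solve-∀

  -- The forward difference of `x ↓ suc e` is `suc e` times `x ↓ e`. The starting point `c` varies
  -- because the induction on `m` moves it.
  sum-↓ : ∀ m c e → + suc e * sum {m} (λ i → (c + + toℕ i) ↓ e) ≡ (c + + m) ↓ suc e - c ↓ suc e
  sum-↓ zero    c e = trans (ℤ.*-zeroʳ (+ suc e))
    (sym (trans (cong (λ d → d ↓ suc e - c ↓ suc e) (ℤ.+-identityʳ c)) (ℤ.+-inverseʳ (c ↓ suc e))))
  sum-↓ (suc m) c e = begin
    + suc e * ((c + 0ℤ) ↓ e + S)
      ≡⟨ cong (λ d → + suc e * (d ↓ e + S)) (ℤ.+-identityʳ c) ⟩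
    + suc e * (c ↓ e + S)
      ≡⟨ cong (λ s → + suc e * (c ↓ e + s)) (sum-cong-≗ {m} λ i → cong (_↓ e) (shift c (+ toℕ i))) ⟩
    + suc e * (c ↓ e + S′)
      ≡⟨ ℤ.*-distribˡ-+ (+ suc e) (c ↓ e) S′ ⟩
    + suc e * c ↓ e + + suc e * S′
      ≡⟨ cong (λ s → + suc e * c ↓ e + s) (sum-↓ m (1ℤ + c) e) ⟩
    + suc e * c ↓ e + ((1ℤ + c + + m) ↓ suc e - (1ℤ + c) ↓ suc e)
      ≡⟨ cong (λ h → + suc e * c ↓ e + ((1ℤ + c + + m) ↓ suc e - h)) (↓-shift c e) ⟩
    + suc e * c ↓ e + ((1ℤ + c + + m) ↓ suc e - (1ℤ + c) * c ↓ e)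
      ≡⟨ lemma (+ e) (c ↓ e) ((1ℤ + c + + m) ↓ suc e) c ⟩
    (1ℤ + c + + m) ↓ suc e - c ↓ suc e
      ≡⟨ cong (λ d → d ↓ suc e - c ↓ suc e) (sym (shift c (+ m))) ⟩
    (c + + suc m) ↓ suc e - c ↓ suc e ∎
    where
    open ≡-Reasoning
    S S′ : ℤ
    S = sum {m} (λ i → (c + + suc (toℕ i)) ↓ e)
    S′ = sum {m} (λ i → (1ℤ + c + + toℕ i) ↓ e)
    shift : ∀ c i → c + (1ℤ + i) ≡ 1ℤ + c + i
    shift = solve-∀
    lemma : ∀ e f g c → (1ℤ + e) * f + (g - (1ℤ + c) * f) ≡ g - f * (c - e)
    lemma = solve-∀

  -- The telescoped sum is the difference of the values of `_↓ suc e` at `p` and at 0, which are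
  -- congruent, and `suc e` is invertible modulo `p`.
  sum-↓≈0 : ∀ e → suc e ℕ.< p → sum {p} (λ i → (+ toℕ i) ↓ e) ≈ 0ℤ
  sum-↓≈0 e e+1<p = resolve (x*y≈0⇒x≈0∨y≈0 (+ suc e) _ product≈0)
    where
    product≈0 : + suc e * sum {p} (λ i → (0ℤ + + toℕ i) ↓ e) ≈ 0ℤ
    product≈0 = ≈-trans (≈-reflexive (sum-↓ p 0ℤ e)) (x≈y⇒x-y≈0 (↓-cong (suc e) p≈0))
    resolve : ∀ {y} → + suc e ≈ 0ℤ ⊎ y ≈ 0ℤ → y ≈ 0ℤ
    resolve (inj₁ se≈0) = contradiction (<⇒≈0⇒≡0 e+1<p se≈0) λ ()
    resolve (inj₂ y≈0)  = y≈0

  -- Monomials in falling factorials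

  monomial : ∀ {k} → Vec ℕ k → Point k → ℤ
  monomial []       []      = 1ℤ
  monomial (e ∷ es) (i ∷ x) = (+ toℕ i) ↓ e * monomial es x

  raise : ∀ {k} → Fin k → Vec ℕ k → Vec ℕ k
  raise i es = es Vec.[ i ]%= suc

  sum-raise : ∀ {k} (i : Fin k) es → Vec.sum (raise i es) ≡ suc (Vec.sum es)
  sum-raise zero    (e ∷ es) = refl
  sum-raise (suc i) (e ∷ es) = trans (cong (e ℕ.+_) (sum-raise i es)) (ℕ.+-suc e (Vec.sum es))

  -- Since x = (x - e) + e, multiplying `x ↓ e` by x gives `x ↓ suc e` plus a multiple of `x ↓ e`:
  -- the degree grows by at most one.
  coord*monomial : ∀ {k} (i : Fin k) es (x : Point k) →
    coord x i * monomial es x ≡ monomial (raise i es) x + + lookup es i * monomial es x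
  coord*monomial zero (e ∷ es) (j ∷ x) = lemma (+ toℕ j) (+ e) ((+ toℕ j) ↓ e) (monomial es x)
    where
    lemma : ∀ x e f m → x * (f * m) ≡ f * (x - e) * m + e * (f * m)
    lemma = solve-∀
  coord*monomial (suc i) (e ∷ es) (j ∷ x) = begin
    c * (f * m)            ≡⟨ lemma c f m ⟩
    f * (c * m)            ≡⟨ cong (f *_) (coord*monomial i es x) ⟩
    f * (m′ + l * m)       ≡⟨ lemma′ f m′ l m ⟩
    f * m′ + l * (f * m)   ∎
    where
    open ≡-Reasoning
    c f m m′ l : ℤ
    c = coord x i
    f = (+ toℕ j) ↓ e
    m = monomial es x
    m′ = monomial (raise i es) x
    l = + lookup es i
    lemma : ∀ c f m → c * (f * m) ≡ f * (c * m)
    lemma = solve-∀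
    lemma′ : ∀ f m′ l m → f * (m′ + l * m) ≡ f * m′ + l * (f * m)
    lemma′ = solve-∀

  -- Exponents with sum below k(p - 1) cannot all be at least p - 1, and the sum over a coordinate
  -- with a smaller exponent vanishes by `sum-↓≈0`.
  ∑-monomial≈0 : ∀ {k} (es : Vec ℕ k) → Vec.sum es ℕ.< k ℕ.* (p ℕ.∸ 1) → ∑ k (monomial es) ≈ 0ℤ
  ∑-monomial≈0 {suc k} (e ∷ es) small with e ℕ.<? p ℕ.∸ 1
  ... | yes e<p-1 = begin
    sum {p} (λ i → ∑ k (λ x → (+ toℕ i) ↓ e * monomial es x))
      ≈⟨ sum-≈ {p} (λ i → ∑-* k ((+ toℕ i) ↓ e) (monomial es)) ⟩
    sum {p} (λ i → (+ toℕ i) ↓ e * ∑ k (monomial es))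
      ≡⟨ *-distribʳ-sum {p} (∑ k (monomial es)) (λ i → (+ toℕ i) ↓ e) ⟨
    sum {p} (λ i → (+ toℕ i) ↓ e) * ∑ k (monomial es)
      ≈⟨ x≈0⇒x*y≈0 (∑ k (monomial es)) (sum-↓≈0 e e+1<p) ⟩
    0ℤ ∎
    where
    open ≈-Reasoning
    e+1<p : suc e ℕ.< p
    e+1<p = subst (suc e ℕ.<_) (ℕ.suc-pred p) (ℕ.s<s e<p-1)
  ... | no e≮p-1 = sum-≈0 {p} (λ i → ≈-trans (∑-* k ((+ toℕ i) ↓ e) (monomial es))
      (x≈0⇒y*x≈0 ((+ toℕ i) ↓ e) (∑-monomial≈0 es small′)))
    where
    small′ : Vec.sum es ℕ.< k ℕ.* (p ℕ.∸ 1)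
    small′ = ℕ.+-cancelˡ-< (p ℕ.∸ 1) _ _
      (ℕ.≤-<-trans (ℕ.+-monoˡ-≤ (Vec.sum es) (ℕ.≮⇒≥ e≮p-1)) small)

  -- Products of affine forms

  -- Linear forms are kept as syntax so that linear parts can be compared with `≡` and treated by
  -- induction.
  data Linear (k : ℕ) : Set where
    𝟎   : Linear k
    var : Fin k → Linear k
    _⊕_ : Linear k → Linear k → Linear k
    ⊖_  : Linear k → Linear k

  ⟦_⟧ : ∀ {k} → Linear k → Point k → ℤ
  ⟦ 𝟎 ⟧     x = 0ℤ
  ⟦ var i ⟧ x = coord x i
  ⟦ l ⊕ m ⟧ x = ⟦ l ⟧ x + ⟦ m ⟧ x
  ⟦ ⊖ l ⟧   x = - ⟦ l ⟧ x

  Affine : ℕ → Set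
  Affine k = Linear k × ℤ

  eval : ∀ {k} → Affine k → Point k → ℤ
  eval (l , c) x = ⟦ l ⟧ x + c

  ∏ : ∀ {k} → List (Affine k) → Point k → ℤ
  ∏ []       x = 1ℤ
  ∏ (f ∷ fs) x = eval f x * ∏ fs x

  ∑-linear≈0 : ∀ {k} (h : Point k → ℤ) → (∀ i → ∑ k (λ x → coord x i * h x) ≈ 0ℤ) →
    ∀ l → ∑ k (λ x → ⟦ l ⟧ x * h x) ≈ 0ℤ
  ∑-linear≈0 h vanish 𝟎       = ∑-≈0 _ (λ x → ≈-reflexive (ℤ.*-zeroˡ (h x)))
  ∑-linear≈0 h vanish (var i) = vanish i
  ∑-linear≈0 {k} h vanish (l ⊕ m) =
    ≈-trans (∑-≡ k (λ x → ℤ.*-distribʳ-+ (h x) (⟦ l ⟧ x) (⟦ m ⟧ x)))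
    (≈-trans (∑-+ k (λ x → ⟦ l ⟧ x * h x) (λ x → ⟦ m ⟧ x * h x))
    (+≈0 (∑-linear≈0 h vanish l) (∑-linear≈0 h vanish m)))
  ∑-linear≈0 {k} h vanish (⊖ l) =
    ≈-trans (∑-≡ k (λ x → lemma (⟦ l ⟧ x) (h x)))
    (≈-trans (∑-* k (- 1ℤ) (λ x → ⟦ l ⟧ x * h x))
    (x≈0⇒y*x≈0 (- 1ℤ) (∑-linear≈0 h vanish l)))
    where
    lemma : ∀ l h → - l * h ≡ - 1ℤ * (l * h)
    lemma = solve-∀

  -- Each form is expanded into the monomial: a coordinate raises one exponent by one or leaves the
  -- monomial unchanged, and so does a constant. The degree of the monomial plus the number of
  -- remaining forms therefore never grows.
  ∑-monomial*∏≈0 : ∀ {k} (fs : List (Affine k)) es →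
    Vec.sum es ℕ.+ length fs ℕ.< k ℕ.* (p ℕ.∸ 1) → ∑ k (λ x → monomial es x * ∏ fs x) ≈ 0ℤ
  ∑-monomial*∏≈0 {k} [] es small = ≈-trans (∑-≡ k (λ x → ℤ.*-identityʳ (monomial es x)))
    (∑-monomial≈0 es (subst (ℕ._< k ℕ.* (p ℕ.∸ 1)) (ℕ.+-identityʳ (Vec.sum es)) small))
  ∑-monomial*∏≈0 {k} ((l , c) ∷ fs) es small =
    ≈-trans (∑-≡ k (λ x → split (monomial es x) (⟦ l ⟧ x) c (∏ fs x)))
    (≈-trans (∑-+ k (λ x → ⟦ l ⟧ x * h x) (λ x → c * h x))
    (+≈0 (∑-linear≈0 h coord≈0 l) (≈-trans (∑-* k c h) (x≈0⇒y*x≈0 c h≈0))))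
    where
    h : Point k → ℤ
    h x = monomial es x * ∏ fs x
    small′ : suc (Vec.sum es ℕ.+ length fs) ℕ.< k ℕ.* (p ℕ.∸ 1)
    small′ = subst (ℕ._< k ℕ.* (p ℕ.∸ 1)) (ℕ.+-suc (Vec.sum es) (length fs)) small
    h≈0 : ∑ k h ≈ 0ℤ
    h≈0 = ∑-monomial*∏≈0 fs es (ℕ.<-trans (ℕ.n<1+n _) small′)
    split : ∀ m l c q → m * ((l + c) * q) ≡ l * (m * q) + c * (m * q)
    split = solve-∀
    expand : ∀ i x → coord x i * h x ≡ monomial (raise i es) x * ∏ fs x + + lookup es i * h x
    expand i x = trans (sym (ℤ.*-assoc (coord x i) (monomial es x) (∏ fs x)))
      (trans (cong (_* ∏ fs x) (coord*monomial i es x))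
             (lemma (monomial (raise i es) x) (+ lookup es i) (monomial es x) (∏ fs x)))
      where
      lemma : ∀ m′ e m q → (m′ + e * m) * q ≡ m′ * q + e * (m * q)
      lemma = solve-∀
    coord≈0 : ∀ i → ∑ k (λ x → coord x i * h x) ≈ 0ℤ
    coord≈0 i = ≈-trans (∑-≡ k (expand i))
      (≈-trans (∑-+ k (λ x → monomial (raise i es) x * ∏ fs x) (λ x → + lookup es i * h x))
      (+≈0 (∑-monomial*∏≈0 fs (raise i es)
              (subst (λ s → s ℕ.+ length fs ℕ.< k ℕ.* (p ℕ.∸ 1)) (sym (sum-raise i es)) small′))
           (≈-trans (∑-* k (+ lookup es i) h) (x≈0⇒y*x≈0 (+ lookup es i) h≈0))))

  ∑-∏≈0 : ∀ {k} (fs : List (Affine k)) → length fs ℕ.< k ℕ.* (p ℕ.∸ 1) → ∑ k (∏ fs) ≈ 0ℤ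
  ∑-∏≈0 {k} fs small = ≈-trans (∑-≡ k (λ x → sym (trans (cong (_* ∏ fs x) (monomial-0 x)) (ℤ.*-identityˡ _))))
    (∑-monomial*∏≈0 fs (Vec.replicate k 0) (subst (λ s → s ℕ.+ length fs ℕ.< k ℕ.* (p ℕ.∸ 1)) (sym (sum-0 k)) small))
    where
    sum-0 : ∀ k → Vec.sum (Vec.replicate k 0) ≡ 0
    sum-0 zero    = refl
    sum-0 (suc k) = sum-0 k
    monomial-0 : ∀ {k} (x : Point k) → monomial (Vec.replicate k 0) x ≡ 1ℤ
    monomial-0 []      = refl
    monomial-0 (i ∷ x) = trans (ℤ.*-identityˡ _) (monomial-0 x)

  infix 4 _≃_
  _≃_ : ∀ {k} → Affine k → Affine k → Set
  f ≃ g = proj₁ f ≡ proj₁ g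

  -- Changing one constant alters the product by a multiple of a product of one factor fewer,
  -- whose sum vanishes.
  ∑-∏-cong : ∀ {k} (es : List (Affine k)) {fs gs} → Pointwise _≃_ fs gs →
    length es ℕ.+ length fs ℕ.≤ k ℕ.* (p ℕ.∸ 1) →
    ∑ k (λ x → ∏ es x * ∏ fs x) ≈ ∑ k (λ x → ∏ es x * ∏ gs x)
  ∑-∏-cong es [] _ = ≈-refl
  ∑-∏-cong {k} es {(l , c) ∷ fs} {(.l , d) ∷ gs} (refl ∷ fs≃gs) small = begin
    ∑ k (λ x → ∏ es x * ((⟦ l ⟧ x + c) * ∏ fs x))
      ≈⟨ ∑-≡ k (λ x → trans (split (∏ es x) (⟦ l ⟧ x) c d (∏ fs x))
                            (cong (λ q → ∏ ((l , d) ∷ es) x * ∏ fs x + (c - d) * q) (sym (∏-++ es fs x)))) ⟩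
    ∑ k (λ x → ∏ ((l , d) ∷ es) x * ∏ fs x + (c - d) * ∏ (es ++ fs) x)
      ≈⟨ ∑-+ k (λ x → ∏ ((l , d) ∷ es) x * ∏ fs x) (λ x → (c - d) * ∏ (es ++ fs) x) ⟩
    S + ∑ k (λ x → (c - d) * ∏ (es ++ fs) x)
      ≈⟨ +-congˡ S (≈-trans (∑-* k (c - d) (∏ (es ++ fs))) (x≈0⇒y*x≈0 (c - d) (∑-∏≈0 (es ++ fs) small″))) ⟩
    S + 0ℤ
      ≡⟨ ℤ.+-identityʳ S ⟩
    S
      ≈⟨ ∑-∏-cong ((l , d) ∷ es) fs≃gs small′ ⟩
    ∑ k (λ x → ∏ ((l , d) ∷ es) x * ∏ gs x)
      ≈⟨ ∑-≡ k (λ x → swap (∏ es x) (⟦ l ⟧ x + d) (∏ gs x)) ⟩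
    ∑ k (λ x → ∏ es x * ((⟦ l ⟧ x + d) * ∏ gs x)) ∎
    where
    open ≈-Reasoning
    S : ℤ
    S = ∑ k (λ x → ∏ ((l , d) ∷ es) x * ∏ fs x)
    small′ : suc (length es ℕ.+ length fs) ℕ.≤ k ℕ.* (p ℕ.∸ 1)
    small′ = subst (ℕ._≤ k ℕ.* (p ℕ.∸ 1)) (ℕ.+-suc (length es) (length fs)) small
    small″ : length (es ++ fs) ℕ.< k ℕ.* (p ℕ.∸ 1)
    small″ = subst (ℕ._< k ℕ.* (p ℕ.∸ 1)) (sym (List.length-++ es)) small′
    ∏-++ : ∀ es fs x → ∏ (es ++ fs) x ≡ ∏ es x * ∏ fs x
    ∏-++ []       fs x = sym (ℤ.*-identityˡ (∏ fs x))
    ∏-++ (e ∷ es) fs x = trans (cong (eval e x *_) (∏-++ es fs x))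
                               (sym (ℤ.*-assoc (eval e x) (∏ es x) (∏ fs x)))
    split : ∀ e l c d f → e * ((l + c) * f) ≡ (l + d) * e * f + (c - d) * (e * f)
    split = solve-∀
    swap : ∀ e l g → l * e * g ≡ e * (l * g)
    swap = solve-∀

  -- With exactly k(p - 1) factors the sum may be nonzero, but every correction term has one factor
  -- fewer and vanishes.
  ∑-∏-independent : ∀ {k} {fs gs : List (Affine k)} → Pointwise _≃_ fs gs →
    length fs ℕ.≤ k ℕ.* (p ℕ.∸ 1) → ∑ k (∏ fs) ≈ ∑ k (∏ gs)
  ∑-∏-independent {k} {fs} {gs} fs≃gs small =
    ≈-trans (∑-≡ k (λ x → sym (ℤ.*-identityˡ (∏ fs x))))
    (≈-trans (∑-∏-cong [] fs≃gs small) (∑-≡ k (λ x → ℤ.*-identityˡ (∏ gs x))))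

-- The factors and their admissible points

tri : ℕ → ℕ
tri zero    = 0
tri (suc n) = suc n ℕ.+ tri n

tri+tri : ∀ k → tri k ℕ.+ tri k ≡ k ℕ.* suc k
tri+tri zero    = refl
tri+tri (suc n) = trans (lemma n (tri n)) (trans (cong (ℕ._+ (2 ℕ.+ 2 ℕ.* n)) (tri+tri n)) (lemma′ n))
  where
  lemma : ∀ n s → ((1 ℕ.+ n) ℕ.+ s) ℕ.+ ((1 ℕ.+ n) ℕ.+ s) ≡ (s ℕ.+ s) ℕ.+ (2 ℕ.+ 2 ℕ.* n)
  lemma = ℕ-solve-∀
  lemma′ : ∀ n → n ℕ.* (1 ℕ.+ n) ℕ.+ (2 ℕ.+ 2 ℕ.* n) ≡ (1 ℕ.+ n) ℕ.* (2 ℕ.+ n)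
  lemma′ = ℕ-solve-∀

tri-mono : ∀ {m n} → m ≤ n → tri m ≤ tri n
tri-mono ℕ.z≤n       = ℕ.z≤n
tri-mono (ℕ.s≤s m≤n) = ℕ.+-mono-≤ (ℕ.s≤s m≤n) (tri-mono m≤n)

-- The pairs (i , j) with i < j. Each unordered pair occurs once, so that it contributes a single
-- sum and a single difference to the factor count.
pairs : ∀ k → List (Fin k × Fin k)
pairs zero    = []
pairs (suc k) = List.tabulate (λ j → zero , suc j) ++ List.map (λ (i , j) → suc i , suc j) (pairs k)

length-pairs : ∀ k → length (pairs (suc k)) ≡ tri k
length-pairs zero    = refl
length-pairs (suc k) = trans (List.length-++ (List.tabulate {n = suc k} (λ j → zero {suc k} , suc j)))
  (cong₂ ℕ._+_ (List.length-tabulate {n = suc k} (λ j → zero {suc k} , suc j)) (trans (List.length-map _ (pairs (suc k))) (length-pairs k)))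

pairs-complete : ∀ {k} {i j : Fin k} → i ≢ j → (i , j) ∈ pairs k ⊎ (j , i) ∈ pairs k
pairs-complete {i = zero}  {zero}  i≢j = contradiction refl i≢j
pairs-complete {i = zero}  {suc j} i≢j = inj₁ (∈-++⁺ˡ (∈-tabulate⁺ j))
pairs-complete {i = suc i} {zero}  i≢j = inj₂ (∈-++⁺ˡ (∈-tabulate⁺ i))
pairs-complete {i = suc i} {suc j} i≢j = Sum.map sucs sucs (pairs-complete (i≢j ∘ cong suc))
  where
  sucs : ∀ {k} {i j : Fin k} → (i , j) ∈ pairs k → (suc i , suc j) ∈ pairs (suc k)
  sucs = ∈-++⁺ʳ _ ∘ ∈-map⁺ _

pairs-sound : ∀ {k} → All (λ (i , j) → i ≢ j) (pairs k)
pairs-sound {zero}  = []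
pairs-sound {suc k} = All.++⁺ (All.tabulate⁺ {n = k} (λ _ ()))
  (All.map⁺ (All.map (_∘ Fin.suc-injective) (pairs-sound {k})))

module Factors (p : ℕ) (p-prime : Prime p) where

  open import Data.Integer.Base using (-_; _+_; _*_; _-_)
  open PrimeMod p p-prime

  private instance
    p-nonZero : ℕ.NonZero p
    p-nonZero = prime⇒nonZero p-prime

  -- These are the values m of the exclusion factors x - m: one of the factors vanishes exactly when
  -- x is congruent to no entry of the given list.
  complement : List ℤ → List ℤ
  complement []      = List.tabulate {n = p} (λ i → + toℕ i)
  complement (a ∷ l) = List.filter (λ m → ¬? (m ≈? a)) (complement l)

  complement-sound : ∀ {m b} l → m ∈ complement l → b ∈ l → m ≉ b
  complement-sound (a ∷ l) m∈ (Any.here refl) = proj₂ (∈-filter⁻ (λ m → ¬? (m ≈? a)) {xs = complement l} m∈)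
  complement-sound (a ∷ l) m∈ (Any.there b∈)  =
    complement-sound l (proj₁ (∈-filter⁻ (λ m → ¬? (m ≈? a)) {xs = complement l} m∈)) b∈

  -- Before filtering, all residues are listed, including that of `z`; so `z` avoids the list only
  -- if its class was filtered out by an entry of `l`.
  complement-complete : ∀ l z → (∀ {m} → m ∈ complement l → z ≉ m) → ∃ λ b → b ∈ l × z ≈ b
  complement-complete [] z z≉ = contradiction (≈-sym (residue-≈ z)) (z≉ (∈-tabulate⁺ (residue z)))
  complement-complete (a ∷ l) z z≉ with z ≈? a
  ... | yes z≈a = a , Any.here refl , z≈a
  ... | no  z≉a with b , b∈l , z≈b ← complement-complete l z (λ {m} m∈ z≈m →
                  z≉ (∈-filter⁺ (λ m → ¬? (m ≈? a)) m∈ (z≉a ∘ ≈-trans z≈m)) z≈m)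
                = b , Any.there b∈l , z≈b

  complement-distinct : ∀ l → AllPairs _≉_ (complement l)
  complement-distinct []      = AllPairs.tabulate⁺ (_∘ toℕ-≈-injective)
  complement-distinct (a ∷ l) = AllPairs.filter⁺ (λ m → ¬? (m ≈? a)) (complement-distinct l)

  -- Pairwise incongruence lets the filter drop only the single entry congruent to `a`.
  length-filter-≉ : ∀ {a b} {M : List ℤ} → AllPairs _≉_ M → b ∈ M → a ≈ b →
    suc (length (List.filter (λ m → ¬? (m ≈? a)) M)) ≡ length M
  length-filter-≉ {a} {b} {m ∷ M} (m≉M ∷ distinct) b∈ a≈b with m ≈? a
  ... | yes m≈a = cong (suc ∘ length)
    (List.filter-all (λ m → ¬? (m ≈? a)) (All.map (λ m≉n n≈a → m≉n (≈-trans m≈a (≈-sym n≈a))) m≉M))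
  length-filter-≉ {a} {b} {m ∷ M} (m≉M ∷ distinct) (Any.here refl) a≈b | no m≉a =
    contradiction (≈-sym a≈b) m≉a
  length-filter-≉ {a} {b} {m ∷ M} (m≉M ∷ distinct) (Any.there b∈) a≈b | no m≉a =
    cong suc (length-filter-≉ distinct b∈ a≈b)

  length-complement : ∀ {l} → AllPairs _≉_ l → length (complement l) ℕ.+ length l ≡ p
  length-complement {[]} [] = trans (ℕ.+-identityʳ _) (List.length-tabulate {n = p} _)
  length-complement {a ∷ l} (a≉l ∷ distinct) = trans (ℕ.+-suc _ (length l))
    (trans (cong (ℕ._+ length l) (length-filter-≉ (complement-distinct l) m∈ a≈m)) (length-complement distinct))
    where
    -- If no remaining entry were congruent to `a`, then `a` would be congruent to an entry of `l`,
    -- against distinctness.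
    missing : ∃ λ m → m ∈ complement l × a ≈ m
    missing with List.filter (a ≈?_) (complement l) in eq
    ... | m ∷ _ = m , ∈-filter⁻ (a ≈?_) {xs = complement l} (subst (m ∈_) (sym eq) (Any.here refl))
    ... | []    with b , b∈l , a≈b ← complement-complete l a (λ {m} m∈ a≈m →
                       contradiction (subst (m ∈_) eq (∈-filter⁺ (a ≈?_) m∈ a≈m)) λ ())
                = contradiction a≈b (All.lookup a≉l b∈l)
    m∈ = proj₁ (proj₂ missing)
    a≈m = proj₂ (proj₂ missing)

  ∏≈0 : ∀ {k} {fs : List (Affine k)} {f} x → f ∈ fs → eval f x ≈ 0ℤ → ∏ fs x ≈ 0ℤ
  ∏≈0 {fs = f ∷ fs} x (Any.here refl) f≈0 = x≈0⇒x*y≈0 (∏ fs x) f≈0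
  ∏≈0 {fs = g ∷ fs} x (Any.there f∈)  f≈0 = x≈0⇒y*x≈0 (eval g x) (∏≈0 x f∈ f≈0)

  1≉0 : 1ℤ ≉ 0ℤ
  1≉0 1≈0 = contradiction (<⇒≈0⇒≡0 (ℕ.nonTrivial⇒n>1 p {{prime⇒nonTrivial p-prime}}) 1≈0) λ ()

  ∏≉0 : ∀ {k} {fs : List (Affine k)} x → All (λ f → eval f x ≉ 0ℤ) fs → ∏ fs x ≉ 0ℤ
  ∏≉0 x []           = 1≉0
  ∏≉0 x (f≉0 ∷ fs≉0) ≈0 = [ f≉0 , ∏≉0 x fs≉0 ]′ (x*y≈0⇒x≈0∨y≈0 _ _ ≈0)

  ∑var : ∀ {m k} → (Fin m → Fin k) → Linear k
  ∑var {zero}  i = 𝟎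
  ∑var {suc m} i = var (i zero) ⊕ ∑var (i ∘ suc)

  ⟦∑var⟧ : ∀ {m k} (i : Fin m → Fin k) x → ⟦ ∑var i ⟧ x ≡ sum (λ j → coord x (i j))
  ⟦∑var⟧ {zero}  i x = refl
  ⟦∑var⟧ {suc m} i x = cong (λ s → coord x (i zero) + s) (⟦∑var⟧ (i ∘ suc) x)

  -- Since `nonOpposite` includes the case i = j, this says that the 2k residues `a i` and `- a i`
  -- are pairwise incongruent.
  record Independent {k} (a : Fin k → ℤ) : Set where
    field
      distinct    : ∀ {i j} → i ≢ j → a i ≉ a j
      nonOpposite : ∀ i j → a i + a j ≉ 0ℤ

    injective : ∀ {i j} → a i ≈ a j → i ≡ j
    injective {i} {j} aᵢ≈aⱼ with i Fin.≟ j
    ... | yes i≡j = i≡j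
    ... | no  i≢j = contradiction aᵢ≈aⱼ (distinct i≢j)

    ≉- : ∀ i j → a i ≉ - a j
    ≉- i j aᵢ≈-aⱼ = nonOpposite i j
      (≈-trans (+-cong aᵢ≈-aⱼ ≈-refl) (≈-reflexive (ℤ.+-inverseˡ (a j))))

  module _ {n t : ℕ} (t≤k : t ℕ.≤ suc n) (a : Fin (suc n) → ℤ) where

    initial : (i : Fin n) → Fin (2 ℕ.+ toℕ i) → Fin (suc n)
    initial i j = Fin.inject≤ j (ℕ.s≤s (Fin.toℕ<n i))

    -- With k = suc n, the sizes are t for the first coordinate and k + i + 1 for coordinate i ≥ 1;
    -- they are chosen to make the number of factors exactly k(p - 1).
    allowed : Fin (suc n) → List ℤ
    allowed zero    = List.tabulate (λ j → a (Fin.inject≤ j t≤k))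
    allowed (suc i) = List.tabulate a ++ List.tabulate (λ j → - a (initial i j))

    length-allowed-suc : ∀ i → length (allowed (suc i)) ≡ suc n ℕ.+ (2 ℕ.+ toℕ i)
    length-allowed-suc i = trans (List.length-++ (List.tabulate a))
      (cong₂ ℕ._+_ (List.length-tabulate a) (List.length-tabulate (λ j → - a (initial i j))))

    allowed-distinct : Independent a → ∀ i → AllPairs _≉_ (allowed i)
    allowed-distinct ind zero = AllPairs.tabulate⁺
      (λ i≢j eq → i≢j (Fin.inject≤-injective t≤k t≤k _ _ (Independent.injective ind eq)))
    allowed-distinct ind (suc i) = AllPairs.++⁺
      (AllPairs.tabulate⁺ distinct)
      (AllPairs.tabulate⁺ {f = λ j → - a (initial i j)} (λ {j} {j′} j≢j′ eq → j≢j′ (Fin.inject≤-injective _ _ _ _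
        (injective (≈-trans (≈-reflexive (sym (ℤ.neg-involutive _)))
                   (≈-trans (-‿cong eq) (≈-reflexive (ℤ.neg-involutive _))))))))
      (All.tabulate⁺ (λ j → All.tabulate⁺ (λ j′ → ≉- j (initial i j′))))
      where open Independent ind

    -- The factors L - c₀ - j (0 < j < p), x_i + x_j and x_i - x_j (i < j), and x_i - b for b
    -- outside the i-th allowed set; L is the sum of all coordinates.
    totalFactors : ℤ → List (Affine (suc n))
    totalFactors c₀ = List.map (λ j → ∑var (λ i → i) , - (c₀ + + suc j)) (List.upTo (p ℕ.∸ 1))

    addition difference : Fin (suc n) × Fin (suc n) → Affine (suc n)
    addition   (i , j) = var i ⊕ var j , 0ℤ
    difference (i , j) = var i ⊕ (⊖ var j) , 0ℤ

    pairFactors : List (Affine (suc n))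
    pairFactors = List.map addition (pairs (suc n)) ++ List.map difference (pairs (suc n))

    exclusions : Fin (suc n) → List (Affine (suc n))
    exclusions i = List.map (λ b → var i , - b) (complement (allowed i))

    factors : ℤ → List (Affine (suc n))
    factors c₀ = totalFactors c₀ ++ pairFactors ++ List.concat (List.tabulate exclusions)

    record Admissible (c₀ : ℤ) (x : Point (suc n)) : Set where
      field
        total≈c₀    : sum (coord x) ≈ c₀
        distinct    : ∀ {i j} → i ≢ j → coord x i ≉ coord x j
        nonOpposite : ∀ {i j} → i ≢ j → coord x i + coord x j ≉ 0ℤ
        isAllowed   : ∀ i → ∃ λ b → b ∈ allowed i × coord x i ≈ b

    ∏≉0⇒admissible : ∀ {c₀ x} → ∏ (factors c₀) x ≉ 0ℤ → Admissible c₀ x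
    ∏≉0⇒admissible {c₀} {x} ∏≉0 = record
      { total≈c₀ = total
      ; distinct = λ i≢j eq → [ (λ ij∈ → nonzero (difference∈ ij∈) (diff eq))
                              , (λ ji∈ → nonzero (difference∈ ji∈) (diff (≈-sym eq))) ]′
                              (pairs-complete i≢j)
      ; nonOpposite = λ {i} {j} i≢j eq →
          [ (λ ij∈ → nonzero (addition∈ ij∈) (plus0 eq))
          , (λ ji∈ → nonzero (addition∈ ji∈)
                       (plus0 (≈-trans (≈-reflexive (ℤ.+-comm (coord x j) (coord x i))) eq))) ]′
          (pairs-complete i≢j)
      ; isAllowed = λ i → complement-complete (allowed i) (coord x i) (λ {m} m∈ eq →
          nonzero (∈-++⁺ʳ (totalFactors c₀) (∈-++⁺ʳ pairFactors
            (∈-concat⁺′ (∈-map⁺ (λ b → var i , - b) m∈) (∈-tabulate⁺ {f = exclusions} i)))) (x≈y⇒x-y≈0 eq))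
      }
      where
      addition∈ : ∀ {ij} → ij ∈ pairs (suc n) → addition ij ∈ factors c₀
      addition∈ ij∈ = ∈-++⁺ʳ (totalFactors c₀) (∈-++⁺ˡ (∈-++⁺ˡ (∈-map⁺ addition ij∈)))

      difference∈ : ∀ {ij} → ij ∈ pairs (suc n) → difference ij ∈ factors c₀
      difference∈ ij∈ = ∈-++⁺ʳ (totalFactors c₀)
        (∈-++⁺ˡ (∈-++⁺ʳ (List.map addition (pairs (suc n))) (∈-map⁺ difference ij∈)))

      nonzero : ∀ {f} → f ∈ factors c₀ → eval f x ≉ 0ℤ
      nonzero f∈ f≈0 = ∏≉0 (∏≈0 x f∈ f≈0)

      plus0 : ∀ {z} → z ≈ 0ℤ → z + 0ℤ ≈ 0ℤ
      plus0 z≈0 = +≈0 z≈0 ≈-refl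

      diff : ∀ {u v} → u ≈ v → (u + - v) + 0ℤ ≈ 0ℤ
      diff eq = plus0 (x≈y⇒x-y≈0 eq)

      L : ℤ
      L = sum (coord x)

      total : L ≈ c₀
      -- A nonzero residue `suc j` of `L - c₀` would make the factor L - c₀ - (j + 1) vanish.
      total with toℕ (residue (L - c₀)) in eq
      ... | zero  = x-y≈0⇒x≈y (≈-trans (≈-sym (residue-≈ (L - c₀))) (≈-reflexive (cong +_ eq)))
      ... | suc j = contradiction vanishing (nonzero (∈-++⁺ˡ (∈-map⁺ _ (∈-upTo⁺ j<p-1))))
        where
        j<p-1 : j ℕ.< p ℕ.∸ 1
        j<p-1 = ℕ.<-pred (subst (suc j ℕ.<_) (sym (ℕ.suc-pred p))
                  (subst (ℕ._< p) eq (Fin.toℕ<n (residue (L - c₀)))))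
        regroup : ∀ L c j → L + - (c + j) ≡ (L - c) - j
        regroup = solve-∀
        vanishing : ⟦ ∑var (λ i → i) ⟧ x + - (c₀ + + suc j) ≈ 0ℤ
        vanishing = ≈-trans
          (≈-reflexive (trans (cong (_+ - (c₀ + + suc j)) (⟦∑var⟧ (λ i → i) x)) (regroup L c₀ (+ suc j))))
          (x≈y⇒x-y≈0 (≈-trans (≈-sym (residue-≈ (L - c₀))) (≈-reflexive (cong +_ eq))))

    admissible⇒∏≉0 : ∀ {c₀ x} → Admissible c₀ x → ∏ (factors c₀) x ≉ 0ℤ
    admissible⇒∏≉0 {c₀} {x} adm = ∏≉0 x (All.++⁺ totals (All.++⁺ (All.++⁺ sums differences)
      (All.concat⁺ (All.tabulate⁺ {f = exclusions} outside))))
      where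
      open Admissible adm

      minus0 : ∀ {z} → z + 0ℤ ≈ 0ℤ → z ≈ 0ℤ
      minus0 = ≈-trans (≈-reflexive (sym (ℤ.+-identityʳ _)))

      sums = All.map⁺ (All.map (λ i≢j eq → nonOpposite i≢j (minus0 eq)) (pairs-sound {suc n}))

      differences = All.map⁺ (All.map (λ i≢j eq → distinct i≢j (x-y≈0⇒x≈y (minus0 eq))) (pairs-sound {suc n}))

      outside : ∀ i → All (λ f → eval f x ≉ 0ℤ) (exclusions i)
      outside i = All.map⁺ (All.tabulate (λ {m} m∈ eq → let b , b∈ , xᵢ≈b = isAllowed i in
        complement-sound (allowed i) m∈ b∈ (≈-trans (≈-sym (x-y≈0⇒x≈y eq)) xᵢ≈b)))

      L : ℤ
      L = sum (coord x)

      regroup : ∀ L c j → c + (L + - (c + j)) ≡ L - j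
      regroup = solve-∀

      regroup′ : ∀ c j → (c + j) ≡ c - (- j)
      regroup′ = solve-∀

      totals : All (λ f → eval f x ≉ 0ℤ) (totalFactors c₀)
      totals = All.map⁺ (All.tabulate (λ {j} j∈ eq → contradiction
        (<⇒≈0⇒≡0 (subst (suc j ℕ.<_) (ℕ.suc-pred p) (ℕ.s<s (∈-upTo⁻ j∈))) (j≈0 j eq)) λ ()))
        where
        j≈0 : ∀ j → ⟦ ∑var (λ i → i) ⟧ x + - (c₀ + + suc j) ≈ 0ℤ → + suc j ≈ 0ℤ
        j≈0 j eq = +-cancelˡ c₀ (≈-trans (≈-sym (x-y≈0⇒x≈y
          (≈-trans (≈-reflexive (cong (_+ - (c₀ + + suc j)) (sym (⟦∑var⟧ (λ i → i) x)))) eq)))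
          (≈-trans total≈c₀ (≈-reflexive (sym (ℤ.+-identityʳ c₀)))))

  -- Linear parts and the number of factors

  map-≃ : ∀ {k} {A : Set} (l : Linear k) (c d : A → ℤ) xs ys → length xs ≡ length ys →
    Pointwise _≃_ (List.map (λ x → l , c x) xs) (List.map (λ y → l , d y) ys)
  map-≃ l c d []       []       eq = []
  map-≃ l c d (x ∷ xs) (y ∷ ys) eq = refl ∷ map-≃ l c d xs ys (ℕ.suc-injective eq)

  module _ {n t : ℕ} (t≤k : t ℕ.≤ suc n) {a b : Fin (suc n) → ℤ}
           (a-ind : Independent a) (b-ind : Independent b) where

    length-allowed≡ : ∀ i → length (allowed t≤k a i) ≡ length (allowed t≤k b i)
    length-allowed≡ zero    = trans (List.length-tabulate {n = t} _) (sym (List.length-tabulate {n = t} _))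
    length-allowed≡ (suc i) = trans (length-allowed-suc t≤k a i) (sym (length-allowed-suc t≤k b i))

    -- `a`, `b`, `c` and `d` enter only the constants, and the lists of excluded values match in
    -- length because the allowed sets do.
    factors-≃ : ∀ c d → Pointwise _≃_ (factors t≤k a c) (factors t≤k b d)
    factors-≃ c d = Pointwise.++⁺ (map-≃ _ _ _ (List.upTo (p ℕ.∸ 1)) (List.upTo (p ℕ.∸ 1)) refl)
      (Pointwise.++⁺ (Pointwise.refl refl {x = pairFactors t≤k a})
      (Pointwise.concat⁺ (Pointwise.tabulate⁺ {n = suc n} (λ i → map-≃ (var i) -_ -_ (complement (allowed t≤k a i)) (complement (allowed t≤k b i))
        (ℕ.+-cancelʳ-≡ (length (allowed t≤k a i)) _ _
          (trans (length-complement (allowed-distinct t≤k a a-ind i))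
          (trans (sym (length-complement (allowed-distinct t≤k b b-ind i)))
                 (cong (length (complement (allowed t≤k b i)) ℕ.+_) (sym (length-allowed≡ i))))))))))

  module _ {n t : ℕ} (t≤k : t ℕ.≤ suc n) {a : Fin (suc n) → ℤ} (a-ind : Independent a) where

    private
      excl : ∀ {m} → (Fin m → Fin (suc n)) → List (Affine (suc n))
      excl f = List.concat (List.tabulate (λ i → exclusions t≤k a (f i)))

    length-exclusions : ∀ i → length (exclusions t≤k a i) ℕ.+ length (allowed t≤k a i) ≡ p
    length-exclusions i = trans (cong (ℕ._+ length (allowed t≤k a i)) (List.length-map _ (complement (allowed t≤k a i))))
      (length-complement (allowed-distinct t≤k a a-ind i))

    -- The offset `c` lets the induction drop the first coordinate. The allowed sets have sizes n +
    -- 3 + c, n + 4 + c, ..., which sum to `m * (2 + n + c) + tri m`.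
    length-excl : ∀ m c (f : Fin m → Fin n) → (∀ i → toℕ (f i) ≡ c ℕ.+ toℕ i) →
      length (excl (suc ∘ f)) ℕ.+ (m ℕ.* (2 ℕ.+ n ℕ.+ c) ℕ.+ tri m) ≡ m ℕ.* p
    length-excl zero    c f f≡ = refl
    length-excl (suc m) c f f≡ = begin
      length (e ++ es) ℕ.+ (suc m ℕ.* (2 ℕ.+ n ℕ.+ c) ℕ.+ tri (suc m))
        ≡⟨ cong (ℕ._+ _) (List.length-++ e) ⟩
      (length e ℕ.+ length es) ℕ.+ (suc m ℕ.* (2 ℕ.+ n ℕ.+ c) ℕ.+ (suc m ℕ.+ tri m))
        ≡⟨ regroup (length e) (length es) m n c (tri m) ⟩
      (length e ℕ.+ (suc n ℕ.+ (2 ℕ.+ c))) ℕ.+ (length es ℕ.+ (m ℕ.* (2 ℕ.+ n ℕ.+ suc c) ℕ.+ tri m))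
        ≡⟨ cong₂ ℕ._+_ head (length-excl m (suc c) (f ∘ suc)
             (λ i → trans (f≡ (suc i)) (ℕ.+-suc c (toℕ i)))) ⟩
      p ℕ.+ m ℕ.* p ∎
      where
      open ≡-Reasoning
      e es : List (Affine (suc n))
      e = exclusions t≤k a (suc (f zero))
      es = excl (suc ∘ f ∘ suc)
      head : length e ℕ.+ (suc n ℕ.+ (2 ℕ.+ c)) ≡ p
      head = trans (cong (length e ℕ.+_) (sym (trans (length-allowed-suc t≤k a (f zero))
               (cong (λ d → suc n ℕ.+ (2 ℕ.+ d)) (trans (f≡ zero) (ℕ.+-identityʳ c))))))
               (length-exclusions (suc (f zero)))
      regroup : ∀ l ls m n c s → (l ℕ.+ ls) ℕ.+ ((1 ℕ.+ m) ℕ.* (2 ℕ.+ n ℕ.+ c) ℕ.+ ((1 ℕ.+ m) ℕ.+ s))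
        ≡ (l ℕ.+ ((1 ℕ.+ n) ℕ.+ (2 ℕ.+ c))) ℕ.+ (ls ℕ.+ (m ℕ.* (2 ℕ.+ n ℕ.+ (1 ℕ.+ c)) ℕ.+ s))
      regroup = ℕ-solve-∀

    -- There are p - 1 total factors, 2 tri n pair factors, and for each coordinate p minus the size
    -- of its allowed set. The size t of the first set is free, and `p ≡ t + tri n` brings the count
    -- to k(p - 1).
    length-factors : p ≡ t ℕ.+ tri n → ∀ c → length (factors t≤k a c) ≡ suc n ℕ.* (p ℕ.∸ 1)
    -- Adding k and the sizes of all allowed sets to both sides avoids truncated subtraction.
    length-factors p≡ c = ℕ.+-cancelʳ-≡ (suc n ℕ.+ (t ℕ.+ (n ℕ.* (2 ℕ.+ n ℕ.+ 0) ℕ.+ tri n))) _ _ (begin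
      length (factors t≤k a c) ℕ.+ (suc n ℕ.+ (t ℕ.+ R))
        ≡⟨ cong (ℕ._+ (suc n ℕ.+ (t ℕ.+ R))) lengths ⟩
      (q ℕ.+ ((tri n ℕ.+ tri n) ℕ.+ (E ℕ.+ F))) ℕ.+ (suc n ℕ.+ (t ℕ.+ R))
        ≡⟨ regroup q (tri n) E F n t R ⟩
      ((1 ℕ.+ q) ℕ.+ (tri n ℕ.+ tri n ℕ.+ n)) ℕ.+ ((E ℕ.+ t) ℕ.+ (F ℕ.+ R))
        ≡⟨ cong₂ (λ u v → (u ℕ.+ (tri n ℕ.+ tri n ℕ.+ n)) ℕ.+ v) (ℕ.suc-pred p) (cong₂ ℕ._+_ E+t F+R) ⟩
      (p ℕ.+ (tri n ℕ.+ tri n ℕ.+ n)) ℕ.+ (p ℕ.+ n ℕ.* p)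
        ≡⟨ cong₂ (λ u v → (u ℕ.+ (tri n ℕ.+ tri n ℕ.+ n)) ℕ.+ (v ℕ.+ n ℕ.* v)) p≡ (sym (ℕ.suc-pred p)) ⟩
      ((t ℕ.+ tri n) ℕ.+ (tri n ℕ.+ tri n ℕ.+ n)) ℕ.+ ((1 ℕ.+ q) ℕ.+ n ℕ.* (1 ℕ.+ q))
        ≡⟨ regroup′ t (tri n) n q ⟩
      suc n ℕ.* q ℕ.+ (suc n ℕ.+ (t ℕ.+ (((tri n ℕ.+ tri n) ℕ.+ n) ℕ.+ tri n)))
        ≡⟨ cong (λ u → suc n ℕ.* q ℕ.+ (suc n ℕ.+ (t ℕ.+ (u ℕ.+ tri n)))) (trans (cong (ℕ._+ n) (tri+tri n)) (final n)) ⟩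
      suc n ℕ.* q ℕ.+ (suc n ℕ.+ (t ℕ.+ R)) ∎)
      where
      open ≡-Reasoning
      q E F R : ℕ
      q = p ℕ.∸ 1
      E = length (exclusions t≤k a zero)
      F = length (excl suc)
      R = n ℕ.* (2 ℕ.+ n ℕ.+ 0) ℕ.+ tri n
      lengths : length (factors t≤k a c) ≡ q ℕ.+ ((tri n ℕ.+ tri n) ℕ.+ (E ℕ.+ F))
      lengths = trans (List.length-++ (totalFactors t≤k a c)) (cong₂ ℕ._+_
        (trans (List.length-map _ (List.upTo q)) (List.length-upTo q))
        (trans (List.length-++ (pairFactors t≤k a)) (cong₂ ℕ._+_
          (trans (List.length-++ (List.map _ (pairs (suc n)))) (cong₂ ℕ._+_
            (trans (List.length-map _ (pairs (suc n))) (length-pairs n))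
            (trans (List.length-map _ (pairs (suc n))) (length-pairs n))))
          (List.length-++ (exclusions t≤k a zero)))))
      E+t : E ℕ.+ t ≡ p
      E+t = trans (cong (E ℕ.+_) (sym (List.length-tabulate {n = t} _))) (length-exclusions zero)
      F+R : F ℕ.+ R ≡ n ℕ.* p
      F+R = length-excl n 0 (λ i → i) (λ _ → refl)
      final : ∀ n → n ℕ.* (1 ℕ.+ n) ℕ.+ n ≡ n ℕ.* (2 ℕ.+ n ℕ.+ 0)
      final = ℕ-solve-∀
      regroup : ∀ q s E F n t R → (q ℕ.+ ((s ℕ.+ s) ℕ.+ (E ℕ.+ F))) ℕ.+ ((1 ℕ.+ n) ℕ.+ (t ℕ.+ R))
        ≡ ((1 ℕ.+ q) ℕ.+ (s ℕ.+ s ℕ.+ n)) ℕ.+ ((E ℕ.+ t) ℕ.+ (F ℕ.+ R))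
      regroup = ℕ-solve-∀
      regroup′ : ∀ t s n q → ((t ℕ.+ s) ℕ.+ (s ℕ.+ s ℕ.+ n)) ℕ.+ ((1 ℕ.+ q) ℕ.+ n ℕ.* (1 ℕ.+ q))
        ≡ (1 ℕ.+ n) ℕ.* q ℕ.+ ((1 ℕ.+ n) ℕ.+ (t ℕ.+ (((s ℕ.+ s) ℕ.+ n) ℕ.+ s)))
      regroup′ = ℕ-solve-∀

  ∑-factors-independent : ∀ {n t} (t≤k : t ℕ.≤ suc n) → p ≡ t ℕ.+ tri n →
    ∀ {a b} → Independent a → Independent b → ∀ c d →
    ∑ (suc n) (∏ (factors t≤k a c)) ≈ ∑ (suc n) (∏ (factors t≤k b d))
  ∑-factors-independent t≤k p≡ a-ind b-ind c d = ∑-∏-independent (factors-≃ t≤k a-ind b-ind c d)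
    (ℕ.≤-reflexive (length-factors t≤k a-ind p≡ c))

-- Admissible points up to order and signs

module Arrangements (p : ℕ) (p-prime : Prime p) where

  open import Data.Integer.Base using (-_; _+_; _*_; _-_)
  open PrimeMod p p-prime
  open Factors p p-prime

  halve : 2 ℕ.< p → ∀ {x} → x + x ≈ 0ℤ → x ≈ 0ℤ
  halve 2<p {x} 2x≈0 = [ (λ 2≈0 → contradiction (<⇒≈0⇒≡0 2<p 2≈0) λ ()) , id ]′
    (x*y≈0⇒x≈0∨y≈0 (+ 2) x (≈-trans (≈-reflexive (lemma x)) 2x≈0))
    where
    lemma : ∀ x → + 2 * x ≡ x + x
    lemma = solve-∀

  sumℤ : List ℤ → ℤ
  sumℤ = List.foldr _+_ 0ℤ

  sum-tabulate : ∀ {m} (f : Fin m → ℤ) → sum f ≡ sumℤ (List.tabulate f)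
  sum-tabulate {zero}  f = refl
  sum-tabulate {suc m} f = cong (λ s → f zero + s) (sum-tabulate (f ∘ suc))

  infix 4 _≈±_
  _≈±_ : ℤ → ℤ → Set
  x ≈± y = x ≈ y ⊎ x ≈ - y

  Separated : ℤ → ℤ → Set
  Separated x y = x ≉ y × x + y ≉ 0ℤ

  ≈±⇒¬separated : ∀ {x y z} → x ≈± z → y ≈± z → ¬ Separated x y
  ≈±⇒¬separated (inj₁ x≈z) (inj₁ y≈z) (x≉y , _) = x≉y (≈-trans x≈z (≈-sym y≈z))
  ≈±⇒¬separated {z = z} (inj₁ x≈z) (inj₂ y≈-z) (_ , x+y≉0) =
    x+y≉0 (≈-trans (+-cong x≈z y≈-z) (≈-reflexive (ℤ.+-inverseʳ z)))
  ≈±⇒¬separated {z = z} (inj₂ x≈-z) (inj₁ y≈z) (_ , x+y≉0) =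
    x+y≉0 (≈-trans (+-cong x≈-z y≈z) (≈-reflexive (ℤ.+-inverseˡ z)))
  ≈±⇒¬separated (inj₂ x≈-z) (inj₂ y≈-z) (x≉y , _) = x≉y (≈-trans x≈-z (≈-sym y≈-z))

  module _ {k : ℕ} (a : Fin k → ℕ) where

    total : List (Fin k) → ℕ
    total js = sumℕ (List.map a js)

    total-↭ : ∀ P N {js} → P ++ N ↭ js → total P ℕ.+ total N ≡ total js
    total-↭ P N ↭js = trans (sym (sum-++ (List.map a P) (List.map a N)))
      (trans (cong sumℕ (sym (List.map-++ a P N))) (sum-↭ (↭.map⁺ a ↭js)))

    -- The entries are `a j` for the indices in the first list and `- a j` for those in the second,
    -- interleaved; both lists keep the order of the entries.
    data Signed : List ℤ → List (Fin k) → List (Fin k) → Set where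
      []  : Signed [] [] []
      pos : ∀ {x xs j P N} → x ≈ + a j → Signed xs P N → Signed (x ∷ xs) (j ∷ P) N
      neg : ∀ {x xs j P N} → x ≈ - + a j → Signed xs P N → Signed (x ∷ xs) P (j ∷ N)

    signed-sum : ∀ {xs P N} → Signed xs P N → sumℤ xs + + total N ≈ + total P
    signed-sum [] = ≈-refl
    signed-sum (pos {x} {xs} {j} {P} {N} x≈a s) = ≈-trans (≈-reflexive (ℤ.+-assoc x (sumℤ xs) (+ total N)))
      (+-cong x≈a (signed-sum s))
    signed-sum (neg {x} {xs} {j} {P} {N} x≈-a s) =
      ≈-trans (+-cong (+-cong x≈-a ≈-refl) ≈-refl)
      (≈-trans (≈-reflexive (lemma (+ a j) (sumℤ xs) (+ total N))) (signed-sum s))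
      where
      lemma : ∀ a s n → (- a + s) + (a + n) ≡ s + n
      lemma = solve-∀

    all-negative : ∀ {xs N} → Signed xs [] N → All (λ x → ∃ λ j → x ≈ - + a j) xs
    all-negative []             = []
    all-negative (neg x≈-a s) = (_ , x≈-a) ∷ all-negative s

    Within : List (Fin k) → ℤ → Set
    Within js x = ∃ λ j → j ∈ js × x ≈± + a j

    -- Once `x` is plus or minus `a j`, separation keeps every other entry from being so, hence `j`
    -- can leave the pool of indices.
    remove : ∀ {x xs j js} → j ∈ js → x ≈± + a j → All (Separated x) xs → All (Within js) xs →
      ∃ λ js′ → js ↭ j ∷ js′ × All (Within js′) xs
    remove {x} {xs} {j} {js} j∈ x≈± separated within
      with ys , zs , refl ← ∈-∃++ j∈ = ys ++ zs , ↭.shift j ys zs ,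
        All.zipWith (λ (sep , l , l∈ , y≈±) → step sep y≈± (↭.∈-resp-↭ (↭.shift j ys zs) l∈)) (separated , within)
      where
      step : ∀ {y l js} → Separated x y → y ≈± + a l → l ∈ j ∷ js → Within js y
      step sep y≈± (Any.here refl) = contradiction sep (≈±⇒¬separated x≈± y≈±)
      step sep y≈± (Any.there l∈)  = _ , l∈ , y≈±

    -- Each entry uses up one index, and equal lengths leave no index over.
    arrange : ∀ xs {js} → length xs ≡ length js → AllPairs Separated xs → All (Within js) xs →
      ∃₂ λ P N → Signed xs P N × P ++ N ↭ js
    arrange [] {[]} len [] [] = [] , [] , [] , ↭-refl
    arrange (x ∷ xs) len (sep ∷ separated) ((j , j∈ , x≈±) ∷ within)
      with js′ , js↭ , within′ ← remove j∈ x≈± sep within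
      with P , N , s , ↭js′ ← arrange xs (ℕ.suc-injective (trans len (↭.↭-length js↭))) separated within′
      with x≈±
    ... | inj₁ x≈a  = j ∷ P , N , pos x≈a s , ↭-trans (prep j ↭js′) (↭-sym js↭)
    ... | inj₂ x≈-a = P , j ∷ N , neg x≈-a s ,
      ↭-trans (↭.shift j P N) (↭-trans (prep j ↭js′) (↭-sym js↭))

    -- The head has a positive sign by hypothesis; naming its index separately shows that the
    -- positive part `j ∷ P` is nonempty.
    arrange-tail : ∀ {x} xs {j js} → length (x ∷ xs) ≡ length js → AllPairs Separated (x ∷ xs) →
      All (Within js) xs → j ∈ js → x ≈ + a j →
      ∃₂ λ P N → Signed xs P N × j ∷ P ++ N ↭ js
    arrange-tail xs {j} len (sep ∷ separated) within j∈ x≈a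
      with js′ , js↭ , within′ ← remove j∈ (inj₁ x≈a) sep within
      with P , N , s , ↭js′ ← arrange xs (ℕ.suc-injective (trans len (↭.↭-length js↭))) separated within′
      = P , N , s , ↭-trans (prep j ↭js′) (↭-sym js↭)

  module _ {n t : ℕ} (t≤k : t ℕ.≤ suc n) (a : Fin (suc n) → ℕ) where

    -- A permutation of all indices beginning with `j ∷ P` encodes a nonempty set of indices without
    -- repetition, with `N` as its complement.
    ZeroSumFree : Set
    ZeroSumFree = ∀ j P N → j ∷ P ++ N ↭ List.allFin (suc n) → + total a (j ∷ P) ≉ 0ℤ

    +a : Fin (suc n) → ℤ
    +a j = + a j

    admissible⇒arrangement : ∀ {c₀ x} → Admissible t≤k +a c₀ x →
      ∃ λ j → toℕ j ℕ.< t × coord x zero ≈ + a j × ∃₂ λ P N →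
        Signed a (List.tabulate (coord x ∘ suc)) P N × j ∷ P ++ N ↭ List.allFin (suc n)
    admissible⇒arrangement {x = x} adm with isAllowed zero
      where open Admissible adm
    ... | b , b∈ , x₀≈b with j′ , refl ← ∈-tabulate⁻ {f = λ j → +a (Fin.inject≤ j t≤k)} b∈ =
      j , subst (ℕ._< t) (sym (Fin.toℕ-inject≤ j′ t≤k)) (Fin.toℕ<n j′) , x₀≈b ,
      arrange-tail a (List.tabulate (coord x ∘ suc))
        (cong suc (trans (List.length-tabulate (coord x ∘ suc)) (sym (List.length-tabulate {n = n} suc))))
        (AllPairs.tabulate⁺ {f = coord x} (λ i≢j → distinct i≢j , nonOpposite i≢j))
        (All.tabulate⁺ within)
        (∈-allFin j) x₀≈b
      where
      open Admissible adm
      j = Fin.inject≤ j′ t≤k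
      within : ∀ i → Within a (List.allFin (suc n)) (coord x (suc i))
      within i with b , b∈ , xᵢ≈b ← isAllowed (suc i) with ∈-++⁻ (List.tabulate +a) b∈
      ... | inj₁ b∈⁺ with l , refl ← ∈-tabulate⁻ {f = +a} b∈⁺ = l , ∈-allFin l , inj₁ xᵢ≈b
      ... | inj₂ b∈⁻ with l , refl ← ∈-tabulate⁻ {f = λ j → - +a (initial t≤k +a i j)} b∈⁻ =
        initial t≤k +a i l , ∈-allFin _ , inj₂ xᵢ≈b

    -- If T and U are the sums over the positive and negative indices, then c₀ is T - U and the full
    -- sum is T + U.
    admissible⇒total : ∀ {c₀ x} → Admissible t≤k +a c₀ x →
      ∀ {j P N} → coord x zero ≈ + a j → Signed a (List.tabulate (coord x ∘ suc)) P N →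
      j ∷ P ++ N ↭ List.allFin (suc n) →
      c₀ + + total a (List.allFin (suc n)) ≈ + total a (j ∷ P) + + total a (j ∷ P)
    admissible⇒total {c₀} {x} adm {j} {P} {N} x₀≈a s ↭all = begin
      c₀ + + total a (List.allFin (suc n))
        ≈⟨ +-cong (≈-trans (≈-sym (Admissible.total≈c₀ adm)) (≈-reflexive (sum-tabulate (coord x))))
                  (≈-reflexive (cong +_ (sym (total-↭ a (j ∷ P) N ↭all)))) ⟩
      sumℤ xs + (T + + total a N)
        ≡⟨ lemma (sumℤ xs) T (+ total a N) ⟩
      (sumℤ xs + + total a N) + T
        ≈⟨ +-cong (signed-sum a {P = j ∷ P} (pos x₀≈a s)) ≈-refl ⟩
      T + T ∎
      where
      open ≈-Reasoning
      xs : List ℤ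
      xs = List.tabulate (coord x)
      T : ℤ
      T = + total a (j ∷ P)
      lemma : ∀ s t n → s + (t + n) ≡ (s + n) + t
      lemma = solve-∀

    -- With this total, `admissible⇒total` gives 2T = 0 modulo p for the positive part T of an
    -- admissible point, so T itself would be a vanishing nonempty sum.
    ∏-vanishes : 2 ℕ.< p → ZeroSumFree →
      ∀ x → ∏ (factors t≤k +a (- + total a (List.allFin (suc n)))) x ≈ 0ℤ
    ∏-vanishes 2<p zsf x with ∏ (factors t≤k +a (- + total a (List.allFin (suc n)))) x ≈? 0ℤ
    ... | yes ≈0 = ≈0
    ... | no  ≉0 with adm ← ∏≉0⇒admissible t≤k +a {c₀ = - + total a (List.allFin (suc n))} ≉0
                 with j , _ , x₀≈a , P , N , s , ↭all ← admissible⇒arrangement adm =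
      contradiction (≈-trans (≈-sym (admissible⇒total adm x₀≈a s ↭all))
                             (≈-reflexive (ℤ.+-inverseˡ (+ total a (List.allFin (suc n))))))
                    (λ 2T≈0 → zsf j P N ↭all (halve 2<p 2T≈0))

-- The reference configuration

module Reference (p : ℕ) (p-prime : Prime p) {n t s : ℕ} (p≡ : p ≡ suc t ℕ.+ tri n)
                 (s+t≡k : s ℕ.+ suc t ≡ suc n) (2k<p : suc n ℕ.+ suc n ℕ.< p) where

  open import Data.Integer.Base using (-_; _+_; _*_; _-_)
  open PrimeMod p p-prime
  open Factors p p-prime
  open Arrangements p p-prime

  private
    k = suc n

  -- The first allowed set has `suc t` elements here, so it always contains the value at index zero.
  t≤k : suc t ℕ.≤ k
  t≤k = ℕ.m+n≤o⇒n≤o s (ℕ.≤-reflexive s+t≡k)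

  -- The integers s+1, …, k, s, …, 1 in this order.
  abstract

    rℕ : ℕ → ℕ
    rℕ j with j ℕ.<? suc t
    ... | yes _ = suc s ℕ.+ j
    ... | no  _ = k ℕ.∸ j

    rℕ-< : ∀ {j} → j ℕ.< suc t → rℕ j ≡ suc s ℕ.+ j
    rℕ-< {j} j<t with j ℕ.<? suc t
    ... | yes _  = refl
    ... | no j≮t = contradiction j<t j≮t

    rℕ-≥ : ∀ {j} → suc t ℕ.≤ j → rℕ j ≡ k ℕ.∸ j
    rℕ-≥ {j} t≤j with j ℕ.<? suc t
    ... | yes j<t = contradiction t≤j (ℕ.<⇒≱ j<t)
    ... | no  _   = refl

    k∸j≤s : ∀ {j} → suc t ℕ.≤ j → k ℕ.∸ j ℕ.≤ s
    k∸j≤s {j} t≤j = ℕ.≤-trans (ℕ.∸-monoʳ-≤ k t≤j)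
      (ℕ.≤-reflexive (trans (cong (ℕ._∸ suc t) (sym s+t≡k)) (ℕ.m+n∸n≡m s (suc t))))

    r : Fin k → ℕ
    r j = rℕ (toℕ j)

    r-< : ∀ {j} → toℕ j ℕ.< suc t → r j ≡ suc s ℕ.+ toℕ j
    r-< = rℕ-<

    r≥1 : ∀ j → 1 ℕ.≤ r j
    r≥1 j with toℕ j ℕ.<? suc t
    ... | yes _ = ℕ.s≤s ℕ.z≤n
    ... | no  _ = ℕ.m<n⇒0<n∸m (Fin.toℕ<n j)

    r≤k : ∀ j → r j ℕ.≤ k
    r≤k j with toℕ j ℕ.<? suc t
    ... | yes j<t = subst (suc s ℕ.+ toℕ j ℕ.≤_) s+t≡k
      (subst (ℕ._≤ s ℕ.+ suc t) (ℕ.+-suc s (toℕ j)) (ℕ.+-monoʳ-≤ s j<t))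
    ... | no  _   = ℕ.m∸n≤m k (toℕ j)

    r-injective : ∀ {i j} → r i ≡ r j → i ≡ j
    r-injective {i} {j} eq with toℕ i ℕ.<? suc t | toℕ j ℕ.<? suc t
    ... | yes _   | yes _   = Fin.toℕ-injective (ℕ.+-cancelˡ-≡ (suc s) _ _ eq)
    ... | yes _   | no  j≮t = contradiction (subst (ℕ._≤ s) (sym eq) (k∸j≤s (ℕ.≮⇒≥ j≮t))) (ℕ.<⇒≱ (ℕ.m≤m+n (suc s) _))
    ... | no  i≮t | yes _   = contradiction (subst (ℕ._≤ s) eq (k∸j≤s (ℕ.≮⇒≥ i≮t))) (ℕ.<⇒≱ (ℕ.m≤m+n (suc s) _))
    ... | no  _   | no  _   =
      Fin.toℕ-injective (ℕ.∸-cancelˡ-≡ (ℕ.<⇒≤ (Fin.toℕ<n i)) (ℕ.<⇒≤ (Fin.toℕ<n j)) eq)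

    r-zero : r zero ≡ suc s
    r-zero = trans (rℕ-< {0} (ℕ.s≤s ℕ.z≤n)) (ℕ.+-identityʳ (suc s))

    sum-from : ∀ m c → c ℕ.+ m ≡ k → suc t ℕ.≤ c →
      sumℕ (List.tabulate {n = m} (λ i → rℕ (c ℕ.+ toℕ i))) ≡ tri m
    sum-from zero    c c+m≡k t≤c = refl
    sum-from (suc m) c c+m≡k t≤c = cong₂ ℕ._+_ head
      (trans (cong sumℕ (List.tabulate-cong {n = m} (λ i → cong rℕ (ℕ.+-suc c (toℕ i)))))
             (sum-from m (suc c) (trans (sym (ℕ.+-suc c m)) c+m≡k) (ℕ.m≤n⇒m≤1+n t≤c)))
      where
      head : rℕ (c ℕ.+ 0) ≡ suc m
      head = trans (cong rℕ (ℕ.+-identityʳ c)) (trans (rℕ-≥ t≤c)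
        (trans (cong (ℕ._∸ c) (sym c+m≡k)) (ℕ.m+n∸m≡n c (suc m))))

    -- From index c on, the values are s + c + 1, ..., k and then s, ..., 1; adding `tri (s + c)`
    -- completes the first run to 1, ..., k.
    sum-below : ∀ d m c → c ℕ.+ d ≡ suc t → d ℕ.+ m ≡ k ℕ.∸ c → c ℕ.≤ k →
      sumℕ (List.tabulate {n = d ℕ.+ m} (λ i → rℕ (c ℕ.+ toℕ i))) ℕ.+ tri (s ℕ.+ c) ≡ tri k ℕ.+ tri s
    sum-below zero m c c≡t m≡ c≤k = trans
      (cong₂ ℕ._+_ (sum-from m c (trans (cong (c ℕ.+_) m≡) (ℕ.m+[n∸m]≡n c≤k)) (ℕ.≤-reflexive (sym c≡t′)))
                   (cong tri (trans (cong (s ℕ.+_) c≡t′) s+t≡k)))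
      (trans (ℕ.+-comm (tri m) (tri k)) (cong (λ u → tri k ℕ.+ tri u)
        (trans m≡ (trans (cong₂ ℕ._∸_ (sym s+t≡k) c≡t′) (ℕ.m+n∸n≡m s (suc t))))))
      where
      c≡t′ : c ≡ suc t
      c≡t′ = trans (sym (ℕ.+-identityʳ c)) c≡t
    sum-below (suc d) m c c≡t m≡ c≤k = begin
      (rℕ (c ℕ.+ 0) ℕ.+ S) ℕ.+ tri (s ℕ.+ c)
        ≡⟨ cong (λ h → (h ℕ.+ S) ℕ.+ tri (s ℕ.+ c)) head ⟩
      (suc (s ℕ.+ c) ℕ.+ S) ℕ.+ tri (s ℕ.+ c)
        ≡⟨ regroup (suc (s ℕ.+ c)) S (tri (s ℕ.+ c)) ⟩
      S ℕ.+ tri (suc (s ℕ.+ c))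
        ≡⟨ cong₂ (λ u v → u ℕ.+ tri v)
             (cong sumℕ (List.tabulate-cong {n = d ℕ.+ m} (λ i → cong rℕ (ℕ.+-suc c (toℕ i))))) (sym (ℕ.+-suc s c)) ⟩
      sumℕ (List.tabulate {n = d ℕ.+ m} (λ i → rℕ (suc c ℕ.+ toℕ i))) ℕ.+ tri (s ℕ.+ suc c)
        ≡⟨ sum-below d m (suc c) (trans (sym (ℕ.+-suc c d)) c≡t)
             (trans (cong ℕ.pred m≡) (ℕ.pred[m∸n]≡m∸[1+n] k c)) (ℕ.≤-trans c<t t≤k) ⟩
      tri k ℕ.+ tri s ∎
      where
      open ≡-Reasoning
      S : ℕ
      S = sumℕ (List.tabulate {n = d ℕ.+ m} (λ i → rℕ (c ℕ.+ suc (toℕ i))))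
      c<t : c ℕ.< suc t
      c<t = subst (c ℕ.<_) c≡t (ℕ.m<m+n c (ℕ.s≤s ℕ.z≤n))
      head : rℕ (c ℕ.+ 0) ≡ suc (s ℕ.+ c)
      head = trans (cong rℕ (ℕ.+-identityʳ c)) (rℕ-< c<t)
      regroup : ∀ h S T → (h ℕ.+ S) ℕ.+ T ≡ S ℕ.+ (h ℕ.+ T)
      regroup = ℕ-solve-∀

    -- The values are 1, ..., k in another order, and tri k = k + tri n = s + suc t + tri n = s + p.
    -- The estimate in `positive-part` rests on this size.
    total-r : total r (List.allFin k) ≡ s ℕ.+ p
    total-r = trans (cong sumℕ (List.map-tabulate id r))
      (trans (ℕ.+-cancelʳ-≡ (tri s) _ _ (trans (cong₂ ℕ._+_ refl (cong tri (sym (ℕ.+-identityʳ s))))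
        (subst (λ l → sumℕ (List.tabulate {n = l} (λ i → rℕ (toℕ i))) ℕ.+ tri (s ℕ.+ 0) ≡ tri k ℕ.+ tri s)
          (ℕ.m+[n∸m]≡n t≤k) (sum-below (suc t) (k ℕ.∸ suc t) 0 refl (ℕ.m+[n∸m]≡n t≤k) ℕ.z≤n))))
      (trans (cong (ℕ._+ tri n) (sym s+t≡k)) (trans (ℕ.+-assoc s (suc t) (tri n)) (cong (s ℕ.+_) (sym p≡)))))

  +r : Fin k → ℤ
  +r = +a t≤k r

  k<p : k ℕ.< p
  k<p = ℕ.≤-<-trans (ℕ.m≤m+n k k) 2k<p

  2<p : 2 ℕ.< p
  2<p = ℕ.≤-<-trans (ℕ.+-mono-≤ (ℕ.s≤s (ℕ.z≤n {n})) (ℕ.s≤s (ℕ.z≤n {n}))) 2k<p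

  halve-≈ : ∀ {u v} → u + u ≈ v + v → u ≈ v
  halve-≈ {u} {v} eq = x-y≈0⇒x≈y (halve 2<p (≈-trans (≈-reflexive (lemma u v)) (x≈y⇒x-y≈0 eq)))
    where
    lemma : ∀ u v → (u - v) + (u - v) ≡ (u + u) - (v + v)
    lemma = solve-∀

  -- All values lie between 1 and k, and 2k < p, so neither a difference of distinct values nor a
  -- sum of two values is divisible by p.
  r-independent : Independent +r
  r-independent = record
    { distinct = λ {i} {j} i≢j eq →
        i≢j (r-injective (≈⇒≡ (ℕ.≤-<-trans (r≤k i) k<p) (ℕ.≤-<-trans (r≤k j) k<p) eq))
    ; nonOpposite = λ i j eq → contradiction
        (<⇒≈0⇒≡0 (ℕ.≤-<-trans (ℕ.+-mono-≤ (r≤k i) (r≤k j)) 2k<p) eq)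
        (ℕ.m<n⇒n≢0 (ℕ.≤-trans (r≥1 i) (ℕ.m≤m+n (r i) (r j))))
    }

  open Independent r-independent

  target : Fin k → ℤ
  target zero    = +r zero
  target (suc i) = - +r (suc i)

  x* : Point k
  x* = Vec.tabulate (residue ∘ target)

  x*≈target : ∀ i → coord x* i ≈ target i
  x*≈target i = ≈-trans (≈-reflexive (cong (+_ ∘ toℕ) (Vec.lookup∘tabulate (residue ∘ target) i)))
                        (residue-≈ (target i))

  target-separated : ∀ {i j} → i ≢ j → Separated (target i) (target j)
  target-separated {zero}  {zero}  i≢j = contradiction refl i≢j
  target-separated {zero}  {suc j} i≢j = ≉- zero (suc j) , distinct i≢j ∘ x-y≈0⇒x≈y
  target-separated {suc i} {zero}  i≢j = ≉- zero (suc i) ∘ ≈-sym ,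
    distinct (i≢j ∘ sym) ∘ x-y≈0⇒x≈y ∘ ≈-trans (≈-reflexive (ℤ.+-comm (+r zero) (- +r (suc i))))
  target-separated {suc i} {suc j} i≢j =
    (λ eq → distinct i≢j (≈-trans (≈-reflexive (sym (ℤ.neg-involutive _)))
                         (≈-trans (-‿cong eq) (≈-reflexive (ℤ.neg-involutive _))))) ,
    (λ eq → nonOpposite (suc i) (suc j) (≈-trans (≈-reflexive (lemma (+r (suc i)) (+r (suc j)))) (-‿cong eq)))
    where
    lemma : ∀ x y → x + y ≡ - (- x + - y)
    lemma = solve-∀

  c* : ℤ
  c* = sum target

  x*-admissible : Admissible t≤k +r c* x*
  x*-admissible = record
    { total≈c₀    = sum-≈ x*≈target
    ; distinct    = λ {i} {j} i≢j eq → proj₁ (target-separated i≢j)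
        (≈-trans (≈-sym (x*≈target i)) (≈-trans eq (x*≈target j)))
    ; nonOpposite = λ {i} {j} i≢j eq → proj₂ (target-separated i≢j)
        (≈-trans (≈-sym (+-cong (x*≈target i) (x*≈target j))) eq)
    ; isAllowed   = λ i → target i , target∈allowed i , x*≈target i
    }
    where
    target∈allowed : ∀ i → target i ∈ allowed t≤k +r i
    target∈allowed zero    = ∈-tabulate⁺ {f = λ j → +r (Fin.inject≤ j t≤k)} zero
    -- At coordinate `suc i` this is the last of the permitted negatives, hence the index
    -- `Fin.fromℕ`.
    target∈allowed (suc i) = ∈-++⁺ʳ (List.tabulate +r)
      (subst (λ j → - +r j ∈ List.tabulate (λ j → - +r (initial t≤k +r i j)))
        (Fin.toℕ-injective (trans (Fin.toℕ-inject≤ (Fin.fromℕ (suc (toℕ i))) (ℕ.s≤s (Fin.toℕ<n i))) (Fin.toℕ-fromℕ (suc (toℕ i)))))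
        (∈-tabulate⁺ {f = λ j → - +r (initial t≤k +r i j)} (Fin.fromℕ (suc (toℕ i)))))

  c*+total : c* + + total r (List.allFin k) ≡ +r zero + +r zero
  c*+total = trans (cong (λ s → c* + s) (total≡sum (λ i → i)))
    (trans (lemma (+r zero) (sum (λ i → - +r (suc i))) (sum (λ i → +r (suc i))))
    (trans (cong (λ s → (+r zero + +r zero) + s) (cancel (λ i → +r (suc i)))) (ℤ.+-identityʳ _)))
    where
    total≡sum : ∀ {m} (f : Fin m → Fin k) → + total r (List.tabulate f) ≡ sum (λ i → +r (f i))
    total≡sum {zero}  f = refl
    total≡sum {suc m} f = cong (λ s → +r (f zero) + s) (total≡sum (f ∘ suc))
    lemma : ∀ a u v → (a + u) + (a + v) ≡ (a + a) + (u + v)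
    lemma = solve-∀
    cancel : ∀ {m} (f : Fin m → ℤ) → sum (λ i → - f i) + sum f ≡ 0ℤ
    cancel {zero}  f = refl
    cancel {suc m} f = trans (lemma′ (f zero) _ _) (cancel (f ∘ suc))
      where
      lemma′ : ∀ a u v → (- a + u) + (a + v) ≡ u + v
      lemma′ = solve-∀

  -- Let T be the sum of the positive part. It is at least `r j` ≥ s + 1 and at most the full sum s
  -- + p; being congruent to s + 1, it equals s + 1. So `r j` exhausts T, and no further positive
  -- value fits.
  positive-part : ∀ {j P N} → toℕ j ℕ.< suc t → j ∷ P ++ N ↭ List.allFin k →
    + total r (j ∷ P) ≈ +r zero → j ≡ zero × P ≡ []
  positive-part {j} {P} {N} j<t ↭all ≈r₀ = j≡0 , P≡[] P (ℕ.+-cancelˡ-≡ (suc s) _ _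
      (trans (cong (ℕ._+ total r P) (trans (sym r-zero) (cong r (sym j≡0)))) (trans T≡s (sym (ℕ.+-identityʳ (suc s))))))
    where
    T : ℕ
    T = total r (j ∷ P)
    s<rj : suc s ℕ.≤ r j
    s<rj = subst (suc s ℕ.≤_) (sym (r-< j<t)) (ℕ.m≤m+n (suc s) (toℕ j))
    s<T : suc s ℕ.≤ T
    s<T = ℕ.≤-trans s<rj (ℕ.m≤m+n (r j) (total r P))
    T≤ : T ℕ.≤ s ℕ.+ p
    T≤ = subst (T ℕ.≤_) (trans (total-↭ r (j ∷ P) N ↭all) total-r) (ℕ.m≤m+n T (total r N))
    T∸s<p : T ℕ.∸ suc s ℕ.< p
    T∸s<p = ℕ.+-cancelˡ-< (suc s) _ _ (ℕ.≤-<-trans (ℕ.≤-reflexive (ℕ.m+[n∸m]≡n s<T)) (ℕ.s≤s T≤))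
    T≡s : T ≡ suc s
    T≡s = ℕ.≤-antisym (ℕ.m∸n≡0⇒m≤n (<⇒≈0⇒≡0 T∸s<p
      (≈-trans (≈-reflexive (sym (trans (ℤ.m-n≡m⊖n T (suc s)) (ℤ.⊖-≥ s<T))))
               (x≈y⇒x-y≈0 (≈-trans ≈r₀ (≈-reflexive (cong +_ r-zero))))))) s<T
    j≡0 : j ≡ zero
    j≡0 = r-injective (trans (ℕ.≤-antisym (ℕ.≤-trans (ℕ.m≤m+n (r j) (total r P)) (ℕ.≤-reflexive T≡s)) s<rj) (sym r-zero))
    P≡[] : ∀ P → total r P ≡ 0 → P ≡ []
    P≡[] []      _  = refl
    P≡[] (l ∷ P) eq = contradiction eq (ℕ.m<n⇒n≢0 (ℕ.≤-trans (r≥1 l) (ℕ.m≤m+n (r l) (total r P))))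

  admissible⇒signs : ∀ {y} → Admissible t≤k +r c* y →
    coord y zero ≈ +r zero × (∀ i → ∃ λ l → coord y (suc i) ≈ - +r l)
  admissible⇒signs {y} adm
    with j , j<t , y₀≈ , P , N , signed , ↭all ← admissible⇒arrangement t≤k r adm =
    ≈-trans y₀≈ (≈-reflexive (cong +r j≡0)) ,
    All.tabulate⁻ (all-negative r (subst (λ P → Signed r (List.tabulate (coord y ∘ suc)) P N) P≡[] signed))
    where
    positive : j ≡ zero × P ≡ []
    positive = positive-part j<t ↭all (halve-≈
      (≈-trans (≈-sym (admissible⇒total t≤k r adm y₀≈ signed ↭all)) (≈-reflexive c*+total)))
    j≡0 = proj₁ positive
    P≡[] = proj₂ positive

  -- By independence a negative value cannot coincide with a positive one, so it is one of the
  -- negatives permitted at this coordinate.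
  allowed-negative : ∀ i {z l} → z ≈ - +r l → (∃ λ b → b ∈ allowed t≤k +r (suc i) × z ≈ b) →
    ∃ λ q → toℕ q ℕ.≤ suc (toℕ i) × z ≈ - +r q
  allowed-negative i {l = l} z≈- (b , b∈ , z≈b) with ∈-++⁻ (List.tabulate +r) b∈
  ... | inj₁ b∈⁺ with l′ , refl ← ∈-tabulate⁻ {f = +r} b∈⁺ =
    contradiction (≈-trans (≈-sym z≈b) z≈-) (≉- l′ l)
  ... | inj₂ b∈⁻ with l′ , refl ← ∈-tabulate⁻ {f = λ j → - +r (initial t≤k +r i j)} b∈⁻ =
    initial t≤k +r i l′ , subst (ℕ._≤ suc (toℕ i)) (sym (Fin.toℕ-inject≤ l′ _)) (ℕ.≤-pred (Fin.toℕ<n l′)) , z≈b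

  -- Coordinate i + 1 is `- +r q` for some q ≤ i + 1. The choice q = 0 would be opposite to the
  -- first coordinate, and for 0 < q ≤ i the value is taken by an earlier coordinate, so q = i + 1.
  admissible⇒target : ∀ {y} → Admissible t≤k +r c* y → ∀ i → coord y i ≈ target i
  admissible⇒target {y} adm = λ { zero → y₀≈ ; (suc i) → below (suc (toℕ i)) i (ℕ.n<1+n (toℕ i)) }
    where
    module y = Admissible adm
    y₀≈ : coord y zero ≈ +r zero
    y₀≈ = proj₁ (admissible⇒signs adm)
    -- `m` bounds the index for a strong induction.
    below : ∀ m i → toℕ i ℕ.< m → coord y (suc i) ≈ - +r (suc i)
    below (suc m) i i<m = go (allowed-negative i (proj₂ (proj₂ (admissible⇒signs adm) i)) (y.isAllowed (suc i)))
      where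
      go : (∃ λ q → toℕ q ℕ.≤ suc (toℕ i) × coord y (suc i) ≈ - +r q) → coord y (suc i) ≈ - +r (suc i)
      go (zero , _ , yᵢ≈-) = contradiction
        (≈-trans (+-cong y₀≈ yᵢ≈-) (≈-reflexive (ℤ.+-inverseʳ (+r zero)))) (y.nonOpposite λ ())
      go (suc q , ℕ.s≤s q≤i , yᵢ≈-) with q Fin.≟ i
      ... | yes refl = yᵢ≈-
      ... | no q≢i   = contradiction (≈-trans (below m q q<m) (≈-sym yᵢ≈-)) (y.distinct (q≢i ∘ Fin.suc-injective))
        where
        q<m : toℕ q ℕ.< m
        q<m = ℕ.<-≤-trans (ℕ.≤∧≢⇒< q≤i (q≢i ∘ Fin.toℕ-injective)) (ℕ.≤-pred i<m)

  admissible-unique : ∀ {y} → Admissible t≤k +r c* y → y ≡ x*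
  admissible-unique {y} adm = trans (sym (Vec.tabulate∘lookup y)) (Vec.tabulate-cong λ i →
    toℕ-≈-injective (≈-trans (admissible⇒target adm i) (≈-sym (residue-≈ (target i)))))

  -- Every term except the one at `x*` vanishes, and that one does not.
  ∑-reference≉0 : ∑ k (∏ (factors t≤k +r c*)) ≉ 0ℤ
  ∑-reference≉0 ≈0 = admissible⇒∏≉0 t≤k +r x*-admissible (≈-trans (≈-sym (∑-supported x* supported)) ≈0)
    where
    supported : ∀ y → y ≢ x* → ∏ (factors t≤k +r c*) y ≈ 0ℤ
    supported y y≢x* with ∏ (factors t≤k +r c*) y ≈? 0ℤ
    ... | yes ≈0 = ≈0
    ... | no  ≉0 = contradiction (admissible-unique (∏≉0⇒admissible t≤k +r {c₀ = c*} ≉0)) y≢x*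

  zeroSumFree⇒⊥ : ∀ a → Independent (+a t≤k a) → ¬ ZeroSumFree t≤k a
  zeroSumFree⇒⊥ a independent zsf = ∑-reference≉0 (≈-trans
    (∑-factors-independent t≤k p≡ r-independent independent c* (- + total a (List.allFin k)))
    (∑-≈0 k (∏-vanishes t≤k a 2<p zsf)))

-- Subsets of ℤ/pℤ

open import Data.Fin.Subset using (∣_∣)

sumFrom : ∀ {n} → Subset n → ℕ → ℕ
sumFrom []          c = 0
sumFrom (true  ∷ B) c = c ℕ.+ sumFrom B (suc c)
sumFrom (false ∷ B) c = sumFrom B (suc c)

-- The local function in the definition of subsetSum is not in scope; the abstraction of 0 turns
-- the goal into one from which the type of go-sumFrom is inferred by unification.
mutual
  go-sumFrom : ∀ {n} (B : Subset n) c → _ ≡ sumFrom B c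

  subsetSum≡sumFrom : ∀ {n} (B : Subset n) → subsetSum B ≡ sumFrom B 0
  subsetSum≡sumFrom B with 0
  ... | c = go-sumFrom B c

  go-sumFrom []          c = refl
  go-sumFrom (true  ∷ B) c = cong (c ℕ.+_) (go-sumFrom B (suc c))
  go-sumFrom (false ∷ B) c = go-sumFrom B (suc c)

sumFrom-∅ : ∀ n c → sumFrom (∅ {n}) c ≡ 0
sumFrom-∅ zero    c = refl
sumFrom-∅ (suc n) c = sumFrom-∅ n (suc c)

sumFrom-insert : ∀ {n} i (B : Subset n) c → i ∉ₛ B →
  sumFrom (⁅ i ⁆ ∪ B) c ≡ (c ℕ.+ toℕ i) ℕ.+ sumFrom B c
sumFrom-insert zero    (true  ∷ B) c i∉B = contradiction here i∉B
sumFrom-insert zero    (false ∷ B) c i∉B = cong₂ ℕ._+_ (sym (ℕ.+-identityʳ c))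
  (cong (λ B → sumFrom B (suc c)) (Subset.∪-identityˡ B))
sumFrom-insert (suc i) (true  ∷ B) c i∉B = trans
  (cong (c ℕ.+_) (sumFrom-insert i B (suc c) (i∉B ∘ there))) (lemma c (toℕ i) (sumFrom B (suc c)))
  where
  lemma : ∀ c i s → c ℕ.+ (((1 ℕ.+ c) ℕ.+ i) ℕ.+ s) ≡ (c ℕ.+ (1 ℕ.+ i)) ℕ.+ (c ℕ.+ s)
  lemma = ℕ-solve-∀
sumFrom-insert (suc i) (false ∷ B) c i∉B = trans
  (sumFrom-insert i B (suc c) (i∉B ∘ there)) (cong (ℕ._+ sumFrom B (suc c)) (sym (ℕ.+-suc c (toℕ i))))

sumFrom-⊆ : ∀ {n} {A B : Subset n} c → B ⊆ A → sumFrom B c ≤ sumFrom A c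
sumFrom-⊆ {A = []}        {[]}        c B⊆A = ℕ.z≤n
sumFrom-⊆ {A = true  ∷ A} {true  ∷ B} c B⊆A = ℕ.+-monoʳ-≤ c (sumFrom-⊆ (suc c) (Subset.drop-∷-⊆ B⊆A))
sumFrom-⊆ {A = false ∷ A} {true  ∷ B} c B⊆A = contradiction (B⊆A here) λ ()
sumFrom-⊆ {A = true  ∷ A} {false ∷ B} c B⊆A =
  ℕ.≤-trans (sumFrom-⊆ (suc c) (Subset.drop-∷-⊆ B⊆A)) (ℕ.m≤n+m _ c)
sumFrom-⊆ {A = false ∷ A} {false ∷ B} c B⊆A = sumFrom-⊆ (suc c) (Subset.drop-∷-⊆ B⊆A)

∈⇒≤sumFrom : ∀ {n} {i} {B : Subset n} c → i ∈ₛ B → c ℕ.+ toℕ i ≤ sumFrom B c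
∈⇒≤sumFrom {i = zero}  {true  ∷ B} c i∈B = ℕ.+-monoʳ-≤ c ℕ.z≤n
∈⇒≤sumFrom {i = suc i} {true  ∷ B} c (there i∈B) = subst (_≤ c ℕ.+ sumFrom B (suc c)) (sym (ℕ.+-suc c (toℕ i)))
  (ℕ.≤-trans (∈⇒≤sumFrom (suc c) i∈B) (ℕ.m≤n+m _ c))
∈⇒≤sumFrom {i = suc i} {false ∷ B} c (there i∈B) = subst (_≤ sumFrom B (suc c)) (sym (ℕ.+-suc c (toℕ i)))
  (∈⇒≤sumFrom (suc c) i∈B)

image : ∀ {k p} → (Fin k → Fin p) → List (Fin k) → Subset p
image e []       = ∅
image e (j ∷ js) = ⁅ e j ⁆ ∪ image e js

∈-image⁻ : ∀ {k p} (e : Fin k → Fin p) js {x} → x ∈ₛ image e js → ∃ λ j → j ∈ js × x ≡ e j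
∈-image⁻ e []       x∈ = contradiction x∈ Subset.∉⊥
∈-image⁻ e (j ∷ js) x∈ with Subset.x∈p∪q⁻ ⁅ e j ⁆ (image e js) x∈
... | inj₁ x∈ⱼ = j , Any.here refl , Subset.x∈⁅y⁆⇒x≡y (e j) x∈ⱼ
... | inj₂ x∈′ with l , l∈ , x≡ ← ∈-image⁻ e js x∈′ = l , Any.there l∈ , x≡

subsetSum-image : ∀ {k p} (e : Fin k → Fin p) → (∀ {i j} → e i ≡ e j → i ≡ j) →
  ∀ {js} → Unique js → subsetSum (image e js) ≡ sumℕ (List.map (toℕ ∘ e) js)
subsetSum-image {p = p} e e-injective {js} unique = trans (subsetSum≡sumFrom (image e js)) (go unique)
  where
  go : ∀ {js} → Unique js → sumFrom (image e js) 0 ≡ sumℕ (List.map (toℕ ∘ e) js)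
  go []                       = sumFrom-∅ p 0
  go {j ∷ js} (j∉js ∷ unique) = trans (sumFrom-insert (e j) (image e js) 0 ej∉) (cong (toℕ (e j) ℕ.+_) (go unique))
    where
    ej∉ : e j ∉ₛ image e js
    ej∉ ej∈ with l , l∈ , eq ← ∈-image⁻ e js ej∈ = All.lookup j∉js l∈ (e-injective eq)

enumerate : ∀ {n} (A : Subset n) → Fin ∣ A ∣ → Fin n
enumerate (true  ∷ A) zero    = zero
enumerate (true  ∷ A) (suc i) = suc (enumerate A i)
enumerate (false ∷ A) i       = suc (enumerate A i)

enumerate-∈ : ∀ {n} (A : Subset n) i → enumerate A i ∈ₛ A
enumerate-∈ (true  ∷ A) zero    = here
enumerate-∈ (true  ∷ A) (suc i) = there (enumerate-∈ A i)
enumerate-∈ (false ∷ A) i       = there (enumerate-∈ A i)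

enumerate-injective : ∀ {n} (A : Subset n) {i j} → enumerate A i ≡ enumerate A j → i ≡ j
enumerate-injective (true  ∷ A) {zero}  {zero}  eq = refl
enumerate-injective (true  ∷ A) {suc i} {suc j} eq = cong suc (enumerate-injective A (Fin.suc-injective eq))
enumerate-injective (false ∷ A)         eq         = enumerate-injective A (Fin.suc-injective eq)

Unique-++⁻ˡ : ∀ {A : Set} (xs : List A) {ys} → Unique (xs ++ ys) → Unique xs
Unique-++⁻ˡ []       unique           = []
Unique-++⁻ˡ (x ∷ xs) (x∉ ∷ unique) = All.++⁻ˡ xs x∉ ∷ Unique-++⁻ˡ xs unique

-- The upper bound for zero-free sets

crossing : ∀ {p} K → 0 ℕ.< p → p ≤ tri K → ∃ λ n → n ℕ.< K × tri n ℕ.< p × p ≤ tri (suc n)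
crossing zero    0<p p≤ = contradiction p≤ (ℕ.<⇒≱ 0<p)
crossing {p} (suc K) 0<p p≤ with p ℕ.≤? tri K
... | yes p≤′ with n , n<K , bounds ← crossing K 0<p p≤′ = n , ℕ.m<n⇒m<1+n n<K , bounds
... | no  p≰  = K , ℕ.n<1+n K , ℕ.≰⇒> p≰ , p≤

-- This keeps ±1, ..., ±k incongruent modulo p for k = suc n. The bound 2k ≤ tri n begins at n = 4,
-- with equality; smaller n are covered by 11 ≤ p.
tri<p⇒2k<p : ∀ {p} n → 11 ≤ p → tri n ℕ.< p → suc n ℕ.+ suc n ℕ.< p
tri<p⇒2k<p 0 11≤p tri<p = ℕ.≤-trans (ℕ.m≤m+n 3 8) 11≤p
tri<p⇒2k<p 1 11≤p tri<p = ℕ.≤-trans (ℕ.m≤m+n 5 6) 11≤p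
tri<p⇒2k<p 2 11≤p tri<p = ℕ.≤-trans (ℕ.m≤m+n 7 4) 11≤p
tri<p⇒2k<p 3 11≤p tri<p = ℕ.≤-trans (ℕ.m≤m+n 9 2) 11≤p
tri<p⇒2k<p (suc (suc (suc (suc n)))) 11≤p tri<p = ℕ.≤-<-trans (bound n) tri<p
  where
  bound : ∀ n → (5 ℕ.+ n) ℕ.+ (5 ℕ.+ n) ≤ tri (4 ℕ.+ n)
  bound zero    = ℕ.≤-refl
  bound (suc n) = ℕ.≤-trans (ℕ.≤-reflexive (lemma n)) (ℕ.+-mono-≤ (ℕ.m≤m+n 2 (3 ℕ.+ n)) (bound n))
    where
    lemma : ∀ n → (6 ℕ.+ n) ℕ.+ (6 ℕ.+ n) ≡ 2 ℕ.+ ((5 ℕ.+ n) ℕ.+ (5 ℕ.+ n))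
    lemma = ℕ-solve-∀

module _ {p : ℕ} (p-prime : Prime p) (11≤p : 11 ≤ p) where

  open PrimeMod p p-prime
  open Factors p p-prime
  open Arrangements p p-prime

  0<p : 0 ℕ.< p
  0<p = ℕ.≤-trans (ℕ.s≤s ℕ.z≤n) 11≤p

  2<p : 2 ℕ.< p
  2<p = ℕ.≤-trans (ℕ.m≤m+n 3 8) 11≤p

  module _ {A : Subset p} (A-zeroFree : ZeroFree p A) where

    zeroFree⇒total≉0 : ∀ {k} (e : Fin k → Fin p) → (∀ {i j} → e i ≡ e j → i ≡ j) → (∀ i → e i ∈ₛ A) →
      ∀ j {js} → Unique (j ∷ js) → + total (toℕ ∘ e) (j ∷ js) ≉ 0ℤ
    zeroFree⇒total≉0 e e-injective e∈A j {js} unique total≈0 = A-zeroFree (image e (j ∷ js)) image⊆A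
      (e j , Subset.x∈p∪q⁺ (inj₁ (Subset.x∈⁅x⁆ (e j))))
      (subst (p ℕ.∣_) (sym (subsetSum-image e e-injective unique)) (≈0⇒∣ total≈0))
      where
      image⊆A : image e (j ∷ js) ⊆ A
      image⊆A x∈ with l , _ , refl ← ∈-image⁻ e (j ∷ js) x∈ = e∈A l

    -- Opposite elements at different indices would form a zero sum of two elements; an element
    -- opposite to itself would be zero, as p is odd.
    zeroFree⇒independent : ∀ {k} (e : Fin k → Fin p) → (∀ {i j} → e i ≡ e j → i ≡ j) → (∀ i → e i ∈ₛ A) →
      Independent (λ i → + toℕ (e i))
    zeroFree⇒independent {k} e e-injective e∈A = record
      { distinct    = λ i≢j eq → i≢j (e-injective (toℕ-≈-injective eq))
      ; nonOpposite = nonOpposite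
      }
      where
      total≉0 : ∀ j {js} → Unique (j ∷ js) → + total (toℕ ∘ e) (j ∷ js) ≉ 0ℤ
      total≉0 = zeroFree⇒total≉0 e e-injective e∈A
      nonOpposite : ∀ i j → + toℕ (e i) ℤ.+ + toℕ (e j) ≉ 0ℤ
      nonOpposite i j eq with i Fin.≟ j
      ... | yes refl = total≉0 i ([] ∷ [])
        (≈-trans (≈-reflexive (cong +_ (ℕ.+-identityʳ (toℕ (e i))))) (halve 2<p eq))
      ... | no i≢j   = total≉0 i ((i≢j ∷ []) ∷ [] ∷ [])
        (≈-trans (≈-reflexive (cong (λ m → + (toℕ (e i) ℕ.+ m)) (ℕ.+-identityʳ (toℕ (e j))))) eq)

    zeroFree⇒tri<p : tri ∣ A ∣ ℕ.< p
    zeroFree⇒tri<p with p ℕ.≤? tri ∣ A ∣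
    ... | no  p≰ = ℕ.≰⇒> p≰
    ... | yes p≤ with n , n<∣A∣ , tri<p , p≤tri ← crossing ∣ A ∣ 0<p p≤
                 with p ℕ.∸ tri n in p∸tri≡
    ...   | zero  = contradiction (ℕ.m∸n≡0⇒m≤n p∸tri≡) (ℕ.<⇒≱ tri<p)
    ...   | suc t = contradiction zsf (R.zeroSumFree⇒⊥ (toℕ ∘ e) (zeroFree⇒independent e e-injective e∈A))
      where
      -- `suc t` is p - tri n: it is positive because tri n < p, and at most suc n because p ≤ tri
      -- (suc n).
      p≡ : p ≡ suc t ℕ.+ tri n
      p≡ = trans (sym (ℕ.m∸n+n≡m (ℕ.<⇒≤ tri<p))) (cong (ℕ._+ tri n) p∸tri≡)
      t<k : suc t ≤ suc n
      t<k = ℕ.+-cancelʳ-≤ (tri n) _ _ (subst (_≤ suc n ℕ.+ tri n) p≡ p≤tri)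
      module R = Reference p p-prime p≡ (ℕ.m∸n+n≡m t<k) (tri<p⇒2k<p n 11≤p tri<p)
      e : Fin (suc n) → Fin p
      e i = enumerate A (Fin.inject≤ i n<∣A∣)
      e-injective : ∀ {i j} → e i ≡ e j → i ≡ j
      e-injective = Fin.inject≤-injective n<∣A∣ n<∣A∣ _ _ ∘ enumerate-injective A
      e∈A : ∀ i → e i ∈ₛ A
      e∈A i = enumerate-∈ A _
      zsf : ZeroSumFree R.t≤k (toℕ ∘ e)
      -- `j ∷ P` begins a rearrangement of all indices, so it has no repetition.
      zsf j P N ↭all = zeroFree⇒total≉0 e e-injective e∈A j
        (Unique-++⁻ˡ (j ∷ P) (↭ₛ.Unique-resp-↭ (setoid _) (↭⇒↭ₛ (↭-sym ↭all)) (Unique.allFin⁺ (suc n))))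

-- The lower bound from initial segments

-- Position 0 stands for the residue 0, so for k ≤ p the set {1, ..., k} of residues modulo `suc p`
-- is `false ∷ seg k p`.
seg : ℕ → ∀ n → Subset n
seg k       zero    = []
seg zero    (suc n) = false ∷ seg zero n
seg (suc k) (suc n) = true ∷ seg k n

∣seg∣ : ∀ {k n} → k ≤ n → ∣ seg k n ∣ ≡ k
∣seg∣ {zero}  {zero}  _           = refl
∣seg∣ {zero}  {suc n} _           = ∣seg∣ {zero} {n} ℕ.z≤n
∣seg∣ {suc k} {suc n} (ℕ.s≤s k≤n) = cong suc (∣seg∣ k≤n)

sumFrom-seg-zero : ∀ n c → sumFrom (seg 0 n) c ≡ 0
sumFrom-seg-zero zero    c = refl
sumFrom-seg-zero (suc n) c = sumFrom-seg-zero n (suc c)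

sumFrom-seg : ∀ {k n} → k ≤ n → ∀ c → sumFrom (seg k n) (suc c) ℕ.+ tri c ≡ tri (c ℕ.+ k)
sumFrom-seg {n = n} ℕ.z≤n c = trans (cong (ℕ._+ tri c) (sumFrom-seg-zero n (suc c)))
                                    (cong tri (sym (ℕ.+-identityʳ c)))
sumFrom-seg {suc k} {suc n} (ℕ.s≤s k≤n) c = trans (lemma (suc c) (sumFrom (seg k n) (2 ℕ.+ c)) (tri c))
  (trans (sumFrom-seg k≤n (suc c)) (cong tri (sym (ℕ.+-suc c k))))
  where
  lemma : ∀ c s t → (c ℕ.+ s) ℕ.+ t ≡ s ℕ.+ (c ℕ.+ t)
  lemma = ℕ-solve-∀

-- Every nonempty subset sum lies between 1 and `tri k`, hence strictly between 0 and the modulus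
-- `suc p`.
seg-zeroFree : ∀ {k p} → k ≤ p → tri k ℕ.< suc p → ZeroFree (suc p) (false ∷ seg k p)
seg-zeroFree {k} {p} k≤p tri<p B B⊆ (zero  , x∈B) p∣ = contradiction (B⊆ x∈B) λ ()
seg-zeroFree {k} {p} k≤p tri<p B B⊆ (suc x , x∈B) p∣ =
  contradiction (ℕ.∣⇒≤ {{ℕ.>-nonZero 0<sum}} p∣) (ℕ.<⇒≱ sum<p)
  where
  0<sum : 0 ℕ.< subsetSum B
  0<sum = ℕ.≤-trans (ℕ.s≤s ℕ.z≤n) (ℕ.≤-trans (∈⇒≤sumFrom 0 x∈B) (ℕ.≤-reflexive (sym (subsetSum≡sumFrom B))))
  sum<p : subsetSum B ℕ.< suc p
  sum<p = ℕ.≤-<-trans (ℕ.≤-trans (ℕ.≤-reflexive (subsetSum≡sumFrom B)) (ℕ.≤-trans (sumFrom-⊆ 0 B⊆)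
    (ℕ.≤-reflexive (trans (sym (ℕ.+-identityʳ _)) (sumFrom-seg k≤p 0))))) tri<p

k≤tri : ∀ k → k ≤ tri k
k≤tri zero    = ℕ.z≤n
k≤tri (suc k) = ℕ.m≤m+n (suc k) (tri k)

maxZeroFree⇒≥ : ∀ {p} {A : Subset p} → MaxZeroFree p A → ∀ {k} → tri k ℕ.< p → k ≤ ∣ A ∣
maxZeroFree⇒≥ {suc p} {A} (_ , largest) {k} tri<p =
  subst (_≤ ∣ A ∣) (∣seg∣ k≤p) (largest (false ∷ seg k p) (seg-zeroFree k≤p tri<p))
  where
  k≤p : k ≤ p
  k≤p = ℕ.≤-pred (ℕ.≤-<-trans (k≤tri k) tri<p)

-- Triangular numbers near p

k[k+1]/2≡tri : ∀ k → k ℕ.* (k ℕ.+ 1) / 2 ≡ tri k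
k[k+1]/2≡tri k = trans (cong (_/ 2) (trans (cong (k ℕ.*_) (ℕ.+-comm k 1))
  (trans (sym (tri+tri k)) (lemma (tri k))))) (m*n/n≡m (tri k) 2)
  where
  lemma : ∀ t → t ℕ.+ t ≡ t ℕ.* 2
  lemma = ℕ-solve-∀

module _ {p : ℕ} (p-prime : Prime p) (11≤p : 11 ≤ p) where

  -- p ≤ k + 2 would give k² ≤ 2(k + 2), so k is small, while p ≥ 11 makes k at least 9. Hence p
  -- divides no positive number up to k + 2.
  p≰k+2 : ∀ {k} → k ℕ.* k ≤ 2 ℕ.* p → ¬ p ≤ 2 ℕ.+ k
  p≰k+2 {k} k²≤2p p≤ = contradiction 9≤k (ℕ.<⇒≱ k<9)
    where
    9≤k : 9 ≤ k
    9≤k = ℕ.+-cancelˡ-≤ 2 _ _ (ℕ.≤-trans 11≤p p≤)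
    9k≤ : 9 ℕ.* k ≤ 2 ℕ.* (2 ℕ.+ k)
    9k≤ = ℕ.≤-trans (ℕ.*-monoˡ-≤ k 9≤k) (ℕ.≤-trans k²≤2p (ℕ.*-monoʳ-≤ 2 p≤))
    7k≤4 : 7 ℕ.* k ≤ 4
    7k≤4 = ℕ.+-cancelʳ-≤ (2 ℕ.* k) _ _ (subst₂ _≤_ (lemma k) (lemma′ k) 9k≤)
      where
      lemma : ∀ k → 9 ℕ.* k ≡ 7 ℕ.* k ℕ.+ 2 ℕ.* k
      lemma = ℕ-solve-∀
      lemma′ : ∀ k → 2 ℕ.* (2 ℕ.+ k) ≡ 4 ℕ.+ 2 ℕ.* k
      lemma′ = ℕ-solve-∀
    k<9 : k ℕ.< 9
    k<9 = ℕ.≤-<-trans (ℕ.≤-trans (ℕ.m≤n*m k 7) 7k≤4) (ℕ.m≤m+n 5 4)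

  p∤ : ∀ {k} → k ℕ.* k ≤ 2 ℕ.* p → ∀ {m} → 0 ℕ.< m → m ≤ 2 ℕ.+ k → ¬ p ℕ.∣ m
  p∤ k²≤2p 0<m m≤ p∣m = p≰k+2 k²≤2p (ℕ.≤-trans (ℕ.∣⇒≤ {{ℕ.>-nonZero 0<m}} p∣m) m≤)

  -- Otherwise 2p = k(k + 1), and p would divide one of the factors, both too small.
  tri≢p : ∀ k → k ℕ.* k ≤ 2 ℕ.* p → tri k ≢ p
  tri≢p zero    k²≤2p tri≡p = contradiction tri≡p (ℕ.<⇒≢ (ℕ.≤-trans (ℕ.s≤s ℕ.z≤n) 11≤p))
  tri≢p (suc m) k²≤2p tri≡p = [ p∤ k²≤2p (ℕ.s≤s ℕ.z≤n) (ℕ.m≤n+m (suc m) 2)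
                              , p∤ k²≤2p (ℕ.s≤s ℕ.z≤n) (ℕ.n≤1+n (2 ℕ.+ m)) ]′
    (euclidsLemma (suc m) (2 ℕ.+ m) p-prime (subst (p ℕ.∣_) (tri+tri (suc m))
      (subst (λ q → p ℕ.∣ q ℕ.+ q) (sym tri≡p) (ℕ.∣m∣n⇒∣m+n ℕ.∣-refl ℕ.∣-refl))))

  -- 2(p + 1) = k(k + 1) factors as 2p = (k + 2)(k - 1).
  tri≢p+1 : ∀ k → k ℕ.* k ≤ 2 ℕ.* p → tri k ≢ suc p
  tri≢p+1 (suc zero)    k²≤2p tri≡ =
    contradiction (ℕ.suc-injective tri≡) (ℕ.<⇒≢ (ℕ.≤-trans (ℕ.s≤s ℕ.z≤n) 11≤p))
  tri≢p+1 (suc (suc m)) k²≤2p tri≡ = [ p∤ k²≤2p (ℕ.s≤s ℕ.z≤n) ℕ.≤-refl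
                                     , p∤ k²≤2p (ℕ.s≤s ℕ.z≤n) (ℕ.m≤n+m (suc m) 3) ]′
    (euclidsLemma (4 ℕ.+ m) (suc m) p-prime (subst (p ℕ.∣_) 2p≡ (ℕ.∣m∣n⇒∣m+n ℕ.∣-refl ℕ.∣-refl)))
    where
    2p≡ : p ℕ.+ p ≡ (4 ℕ.+ m) ℕ.* suc m
    2p≡ = ℕ.+-cancelˡ-≡ 2 _ _ (trans (lemma p)
      (trans (sym (cong₂ ℕ._+_ tri≡ tri≡)) (trans (tri+tri (2 ℕ.+ m)) (lemma′ m))))
      where
      lemma : ∀ p → 2 ℕ.+ (p ℕ.+ p) ≡ (1 ℕ.+ p) ℕ.+ (1 ℕ.+ p)
      lemma = ℕ-solve-∀
      lemma′ : ∀ m → (2 ℕ.+ m) ℕ.* (3 ℕ.+ m) ≡ 2 ℕ.+ (4 ℕ.+ m) ℕ.* (1 ℕ.+ m)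
      lemma′ = ℕ-solve-∀

  -- The values p and p + 1 are excluded, so the threshold p + 1 amounts to the condition tri k < p
  -- under which {1, ..., k} is zero-free.
  tri≤p+1⇒tri<p : ∀ {k} → k ℕ.* k ≤ 2 ℕ.* p → tri k ≤ p ℕ.+ 1 → tri k ℕ.< p
  tri≤p+1⇒tri<p {k} k²≤2p tri≤ = ℕ.≤∧≢⇒<
    (ℕ.≤-pred (ℕ.≤∧≢⇒< (subst (tri k ≤_) (ℕ.+-comm p 1) tri≤) (tri≢p+1 k k²≤2p))) (tri≢p k k²≤2p)

-- For n > k, twice `tri n` is at least (k + 1)(k + 2), which already exceeds 2p.
tri<p⇒≤ : ∀ {p k n} → 2 ℕ.* p ℕ.< suc k ℕ.* suc k → tri n ℕ.< p → n ≤ k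
tri<p⇒≤ {p} {k} {n} 2p< tri<p = ℕ.≮⇒≥ λ k<n → ℕ.<-irrefl refl (begin-strict
  2 ℕ.* p                          <⟨ 2p< ⟩
  suc k ℕ.* suc k                  ≤⟨ ℕ.*-monoʳ-≤ (suc k) (ℕ.n≤1+n (suc k)) ⟩
  suc k ℕ.* (2 ℕ.+ k)              ≡⟨ tri+tri (suc k) ⟨
  tri (suc k) ℕ.+ tri (suc k)      ≤⟨ ℕ.+-mono-≤ (tri-mono k<n) (tri-mono k<n) ⟩
  tri n ℕ.+ tri n                  ≤⟨ ℕ.+-mono-≤ (ℕ.<⇒≤ tri<p) (ℕ.<⇒≤ tri<p) ⟩
  p ℕ.+ p                          ≡⟨ cong (p ℕ.+_) (ℕ.+-identityʳ p) ⟨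
  2 ℕ.* p                          ∎)
  where open ℕ.≤-Reasoning

-- 2 tri m = m(m + 1) is smaller than (m + 1)²; with m + 1 the integer part of √(2p) this makes {1,
-- ..., m} zero-free.
square≤2p⇒tri<p : ∀ {p} m → suc m ℕ.* suc m ≤ 2 ℕ.* p → tri m ℕ.< p
square≤2p⇒tri<p {p} m m²≤2p = ℕ.≰⇒> λ p≤tri → ℕ.<-irrefl refl (begin-strict
  2 ℕ.* p           ≡⟨ cong (p ℕ.+_) (ℕ.+-identityʳ p) ⟩
  p ℕ.+ p           ≤⟨ ℕ.+-mono-≤ p≤tri p≤tri ⟩
  tri m ℕ.+ tri m   ≡⟨ tri+tri m ⟩
  m ℕ.* suc m       <⟨ ℕ.*-monoˡ-< (suc m) (ℕ.n<1+n m) ⟩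
  suc m ℕ.* suc m   ≤⟨ m²≤2p ⟩
  2 ℕ.* p           ∎)
  where open ℕ.≤-Reasoning

-- The cardinality of a largest zero-free set

open import Data.Nat using (_+_; _*_; _∸_)

theorem6 : Σ ℕ λ P₀ → ∀ (p : ℕ) → Prime p → P₀ ≤ p →
    ∀ (A : Subset p) → MaxZeroFree p A →
    ∀ (k : ℕ) → IsFloorSqrt (2 * p) k →
    ((k * (k + 1) / 2 ≤ p + 1 → ∣ A ∣ ≡ k) ×
    (k * (k + 1) / 2 > p + 1 → ∣ A ∣ ≡ k ∸ 1))
-- From 11 on, tri n < p implies 2(n + 1) < p, and tri k is neither p nor p + 1 when k² ≤ 2p.
theorem6 = 11 , λ p p-prime 11≤p A maximal k (k²≤2p , 2p<) →
  let upper = zeroFree⇒tri<p p-prime 11≤p (proj₁ maximal) in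
  (λ tri≤ → ℕ.≤-antisym (tri<p⇒≤ 2p< upper) (maxZeroFree⇒≥ maximal
     (tri≤p+1⇒tri<p p-prime 11≤p {k} k²≤2p (subst (_≤ p + 1) (k[k+1]/2≡tri k) tri≤)))) ,
  (λ tri> → large maximal upper {k} k²≤2p (subst (_> p + 1) (k[k+1]/2≡tri k) tri>))
  where
  large : ∀ {p} {A : Subset p} → MaxZeroFree p A → tri ∣ A ∣ ℕ.< p →
    ∀ {k} → k * k ≤ 2 * p → tri k > p + 1 → ∣ A ∣ ≡ k ∸ 1
  large maximal upper {zero} k²≤2p ()
  large {p} {A} maximal upper {suc m} k²≤2p tri> = ℕ.≤-antisym
    -- More than m elements in `A` would give p + 1 < tri (suc m) ≤ tri ∣ A ∣ < p.
    (ℕ.≮⇒≥ λ m<∣A∣ → ℕ.<-asym upper (ℕ.<-≤-trans (ℕ.≤-<-trans (ℕ.m≤m+n p 1) tri>) (tri-mono m<∣A∣)))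
    (maxZeroFree⇒≥ maximal (square≤2p⇒tri<p m k²≤2p))
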